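{- Let $k \geq 6$ be even, let $y \geq 1$ be odd, let $x$ be a positive integer with $x \neq 2$, and put $u = 4x$ and $g = ky$. Then there exists a $k$-ARCS of $(K_u \times K_g)(2)$.
   Context: For graphs $G,H$, the tensor product $G \times H$ has vertex set $V(G)\times V(H)$, with $(g_1,h_1)$ adjacent to $(g_2,h_2)$ iff $g_1g_2 \in E(G)$ and $h_1h_2 \in E(H)$. For a graph $G$ and positive integer $\lambda$, $G(\lambda)$ is the multigraph obtained by replacing each edge of $G$ by $\lambda$ parallel edges. $K_n$ is the complete graph on $n$ vertices. $(K_u \times K_g)(\lambda)$ is regarded as a $u$-partite multigraph with partite sets $V_i = \{i\}\times V(K_g)$, $i=1,\dots,u$. A partial $C_k$-factor of $(K_u \times K_g)(\lambda)$ is a subgraph which, for some $i$, is a spanning subgraph of $(K_u \times K_g)(\lambda)\setminus V_i$ all of whose components are cycles of length $k$. A $k$-ARCS of $(K_u \times K_g)(\lambda)$ is a partition of its edge multiset into partial $C_k$-factors. -}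

module Defs where

open import Data.Nat using (ℕ; _*_)
open import Data.Fin using (Fin)
import Data.Fin.Properties as FinP
import Data.Product
open import Data.Product using (_×_; _,_; proj₁; proj₂)
import Data.Product.Properties as ProdP
open import Data.Sum using (_⊎_)
open import Data.Sum.Relation.Unary.All using () 
open import Data.List using (List; []; _∷_; _++_; [_]; zip; concat; concatMap; map; length; filter)
open import Data.List.Relation.Unary.All using (All)
open import Data.List.Relation.Unary.Unique.Propositional using (Unique)
open import Data.Vec using (Vec; toList)
open import Relation.Nullary using (¬_; Dec)
open import Relation.Nullary.Decidable using (_⊎-dec_)
open import Relation.Binary.PropositionalEquality using (_≡_; _≢_)
open import Relation.Binary.Definitions using (DecidableEquality)

-- Vertices of K_u × K_g : pairs (i , h) ; partite set V_i = {i} × V(K_g).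
Vertex : ℕ → ℕ → Set
Vertex u g = Fin u × Fin g

_≟V_ : ∀ {u g} → DecidableEquality (Vertex u g)
_≟V_ = ProdP.≡-dec FinP._≟_ FinP._≟_

Adj : ∀ {u g} → Vertex u g → Vertex u g → Set
Adj (a , b) (c , d) = (a ≢ c) × (b ≢ d)

cycEdges : ∀ {A : Set} → List A → List (A × A)
cycEdges [] = []
cycEdges (x ∷ xs) = zip (x ∷ xs) (xs ++ [ x ])

record IsCycle {u g k : ℕ} (c : Vec (Vertex u g) k) : Set where
  field
    distinct : Unique (toList c)
    adjacent : All (λ e → Adj (proj₁ e) (proj₂ e)) (cycEdges (toList c))

occ : ∀ {u g} → Vertex u g → List (Vertex u g) → ℕ
occ v xs = length (filter (λ w → w ≟V v) xs)

record PartialFactor (u g k : ℕ) : Set where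
  field
    missing : Fin u
    cycles  : List (Vec (Vertex u g) k)
    cyclesOk : All IsCycle cycles
    coverOut : ∀ (v : Vertex u g) → proj₁ v ≢ missing →
               occ v (concatMap toList cycles) ≡ 1
    coverIn  : ∀ (v : Vertex u g) → proj₁ v ≡ missing →
               occ v (concatMap toList cycles) ≡ 0

open PartialFactor public

factorEdges : ∀ {u g k} → PartialFactor u g k → List (Vertex u g × Vertex u g)
factorEdges F = concatMap (λ c → cycEdges (toList c)) (cycles F)

edgeMult : ∀ {u g} → Vertex u g → Vertex u g →
           List (Vertex u g × Vertex u g) → ℕ
edgeMult v w es =
  length (filter (λ e → ((proj₁ e ≟V v) ×-d (proj₂ e ≟V w))
                       ⊎-dec ((proj₁ e ≟V w) ×-d (proj₂ e ≟V v))) es)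
  where
  open import Relation.Nullary.Decidable using () renaming (_×-dec_ to _×-d_)

-- A k-ARCS of (K_u × K_g)(λ): a family of partial C_k-factors whose
-- edges together use every edge vw of K_u × K_g exactly λ times
-- (cycle edges are always edges of K_u × K_g by IsCycle).
ARCS : ℕ → ℕ → ℕ → ℕ → Set
ARCS k u g λ' =
  Data.Product.Σ (List (PartialFactor u g k)) λ Fs →
    ∀ (v w : Vertex u g) → Adj v w →
      edgeMult v w (concatMap factorEdges Fs) ≡ λ'

{-# OPTIONS --safe #-}
module Submission where

-- A cycle system on g points partitions the edges of 2K_g into C_k-factors. Given one with k even and an idempotent
-- Latin square σ of order u, send a cycle (c₀ , c₁ , c₂ , …) to the cycles (a , c₀) (σ i a , c₁) (a , c₂) … for all
-- a ≢ i: together they miss V_i, and since each pair of rows a ≢ b arises from exactly one i in each of the two orders,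
-- every edge of 2K_g lifts to all the edges it should. Idempotent Latin squares of even order exist by prolongation.
-- For the system with g = ky, cut the points into 2y blocks of size m = k/2 and take a 1-factorization of K_{2y}. Its
-- first 1-factor pairs the blocks up into sets of size k, which carry Walecki's Hamiltonian cycles of 2K_k; for the
-- other 1-factors, 2K_{m,m} splits into Hamiltonian cycles by differences modulo m.

open import Defs
open import Algebra.Properties.CommutativeSemigroup using (interchange; x∙yz≈y∙xz)
open import Data.Empty using (⊥-elim)
open import Data.Fin using (Fin; zero; suc; toℕ; fromℕ<; combine; splitAt; _↑ˡ_; _↑ʳ_; _≟_)
import Data.Fin.Properties as Fin
open import Data.Integer.DivMod using (n%ℕd<d; a≡a%ℕn+[a/ℕn]*n; _/ℕ_; _%ℕ_)
import Data.Integer.Properties as ℤ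
import Data.Integer.Tactic.RingSolver as ℤ
open import Data.List using (List; []; _∷_; [_]; _++_; map; concatMap; length; filter; tabulate; allFin; upTo; applyUpTo; zip; zipWith)
open import Data.List.Membership.Propositional using (_∈_)
open import Data.List.Membership.Propositional.Properties using (∈-map⁺; ∈-allFin)
open import Data.List.Properties using (length-map; length-tabulate; map-++; zipWith-map; map-zipWith)
open import Data.List.Relation.Unary.All as All using (All; []; _∷_)
import Data.List.Relation.Unary.All.Properties as All
open import Data.List.Relation.Unary.Any using (here; there)
open import Data.List.Relation.Unary.Unique.Propositional using (Unique; []; _∷_)
import Data.List.Relation.Unary.Unique.Propositional.Properties as Unique
open import Data.Nat using (ℕ; zero; suc; _+_; _*_; _∸_; _≤_; _<_; _<?_; z≤n; s≤s; s≤s⁻¹; z<s; s<s)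
open import Data.Nat.Divisibility using (_∣_; divides; _∣0; >⇒∤)
open import Data.Nat.Properties hiding (_≟_)
open import Data.Nat.Tactic.RingSolver using (solve-∀)
open import Data.Product as Product using (_×_; _,_; proj₁; proj₂; ∃)
open import Data.Sum using (inj₁; inj₂; [_,_]′)
open import Data.Vec as Vec using (Vec; []; _∷_; toList)
open import Data.Vec.Properties using (toList-map; length-toList)
open import Function using (_∘_; id)
open import Relation.Binary.PropositionalEquality hiding ([_])
open import Relation.Nullary using (¬_; Dec; yes; no)
open import Relation.Nullary.Decidable using (_×-dec_; _⊎-dec_; ¬?)

-- Doubling is what makes a cycle system on the g points possible: g = ky is even, so K_g has odd
-- degree and no decomposition into 2-factors, whereas 2K_g splits into g - 1 of them. The lift
-- works because row i of the square permutes the rows other than i without fixed points: each such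
-- row b is once a source and once a target of an arc. A point h lies on a single cycle of a factor,
-- in a single position; if the position is even, (b , h) is met by the arc leaving b, if odd by the
-- arc entering b, so it is met exactly once. In the block construction the edges inside the blocks
-- must be used up exactly once, which is why just one 1-factor is spent on copies of 2K_k; these
-- use the edges inside both blocks of a pair along with those between them. The block size k/2 is
-- forced by the other 1-factors, since a Hamiltonian cycle of K_{m,m} has length 2m. All covering
-- and multiplicity claims are sums of 0-1 indicators, so they come down to exchanging sums and
-- polynomial identities.

private variable
  A B : Set
  P Q R : Set

-- Indicators and finite sums

δ : Dec P → ℕ
δ (yes _) = 1
δ (no _)  = 0

δ-yes : (d : Dec P) → P → δ d ≡ 1
δ-yes (yes _) _ = refl
δ-yes (no ¬p) p = ⊥-elim (¬p p)

δ-no : (d : Dec P) → ¬ P → δ d ≡ 0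
δ-no (yes p) ¬p = ⊥-elim (¬p p)
δ-no (no _)  _  = refl

δ-⇔ : (d : Dec P) (e : Dec Q) → (P → Q) → (Q → P) → δ d ≡ δ e
δ-⇔ (yes p) e f g = sym (δ-yes e (f p))
δ-⇔ (no ¬p) e f g = sym (δ-no e (¬p ∘ g))

δ-× : (d : Dec P) (e : Dec Q) → δ (d ×-dec e) ≡ δ d * δ e
δ-× (yes _) (yes _) = refl
δ-× (yes _) (no _)  = refl
δ-× (no _)  _       = refl

δ-⊎ : (d : Dec P) (e : Dec Q) → (P → ¬ Q) → δ (d ⊎-dec e) ≡ δ d + δ e
δ-⊎ (yes p) (yes q) f = ⊥-elim (f p q)
δ-⊎ (yes _) (no _)  f = refl
δ-⊎ (no _)  (yes _) f = refl
δ-⊎ (no _)  (no _)  f = refl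

δ-factor : (d : Dec P) (e : Dec Q) (f : Dec R) → (P → Q × R) → (Q → R → P) → δ d ≡ δ e * δ f
δ-factor d e f to from = trans (δ-⇔ d (e ×-dec f) to (λ { (q , r) → from q r })) (δ-× e f)

∑ : List A → (A → ℕ) → ℕ
∑ []       f = 0
∑ (x ∷ xs) f = f x + ∑ xs f

infixr 8 ∑
syntax ∑ xs (λ x → e) = ∑[ x ∈ xs ] e

length-filter-∑ : {P : A → Set} (P? : ∀ x → Dec (P x)) (xs : List A) →
  length (filter P? xs) ≡ ∑[ x ∈ xs ] δ (P? x)
length-filter-∑ P? []       = refl
length-filter-∑ P? (x ∷ xs) with P? x
... | yes _ = cong suc (length-filter-∑ P? xs)
... | no _  = length-filter-∑ P? xs

∑-cong : (xs : List A) {f g : A → ℕ} → (∀ x → f x ≡ g x) → ∑ xs f ≡ ∑ xs g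
∑-cong []       f≗g = refl
∑-cong (x ∷ xs) f≗g = cong₂ _+_ (f≗g x) (∑-cong xs f≗g)

∑-cong-All : {xs : List A} {f g : A → ℕ} → All (λ x → f x ≡ g x) xs → ∑ xs f ≡ ∑ xs g
∑-cong-All []         = refl
∑-cong-All (eq ∷ eqs) = cong₂ _+_ eq (∑-cong-All eqs)

∑-zero : (xs : List A) {f : A → ℕ} → (∀ x → f x ≡ 0) → ∑ xs f ≡ 0
∑-zero []       f≗0 = refl
∑-zero (x ∷ xs) f≗0 rewrite f≗0 x = ∑-zero xs f≗0

∑-one : (xs : List A) → ∑[ _ ∈ xs ] 1 ≡ length xs
∑-one []       = refl
∑-one (x ∷ xs) = cong suc (∑-one xs)

∑-++ : (xs ys : List A) {f : A → ℕ} → ∑ (xs ++ ys) f ≡ ∑ xs f + ∑ ys f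
∑-++ []       ys     = refl
∑-++ (x ∷ xs) ys {f} = trans (cong (f x +_) (∑-++ xs ys)) (sym (+-assoc (f x) _ _))

∑-map : (g : A → B) (xs : List A) {f : B → ℕ} → ∑ (map g xs) f ≡ ∑[ x ∈ xs ] f (g x)
∑-map g []           = refl
∑-map g (x ∷ xs) {f} = cong (f (g x) +_) (∑-map g xs)

∑-concatMap : (g : A → List B) (xs : List A) {f : B → ℕ} →
  ∑ (concatMap g xs) f ≡ ∑[ x ∈ xs ] ∑ (g x) f
∑-concatMap g []           = refl
∑-concatMap g (x ∷ xs) {f} = trans (∑-++ (g x) _) (cong (∑ (g x) f +_) (∑-concatMap g xs))

∑-+ : (xs : List A) (f g : A → ℕ) → ∑[ x ∈ xs ] (f x + g x) ≡ ∑ xs f + ∑ xs g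
∑-+ []       f g = refl
∑-+ (x ∷ xs) f g = trans (cong (f x + g x +_) (∑-+ xs f g)) (interchange +-commutativeSemigroup (f x) (g x) _ _)

∑-*ˡ : (xs : List A) (c : ℕ) (f : A → ℕ) → ∑[ x ∈ xs ] (c * f x) ≡ c * ∑ xs f
∑-*ˡ []       c f = sym (*-zeroʳ c)
∑-*ˡ (x ∷ xs) c f = trans (cong (c * f x +_) (∑-*ˡ xs c f)) (sym (*-distribˡ-+ c (f x) _))

∑-*ʳ : (xs : List A) (c : ℕ) (f : A → ℕ) → ∑[ x ∈ xs ] (f x * c) ≡ ∑ xs f * c
∑-*ʳ xs c f = trans (∑-cong xs (λ x → *-comm (f x) c)) (trans (∑-*ˡ xs c f) (*-comm c _))

∑-swap : (xs : List A) (ys : List B) (f : A → B → ℕ) →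
  ∑[ x ∈ xs ] ∑[ y ∈ ys ] f x y ≡ ∑[ y ∈ ys ] ∑[ x ∈ xs ] f x y
∑-swap []       ys f = sym (∑-zero ys (λ _ → refl))
∑-swap (x ∷ xs) ys f =
  trans (cong (∑ ys (f x) +_) (∑-swap xs ys f)) (sym (∑-+ ys (f x) _))

∑-tabulate-single : ∀ {n} (g : Fin n → A) (f : A → ℕ) (x₀ : Fin n) →
  (∀ x → x ≢ x₀ → f (g x) ≡ 0) → ∑ (tabulate g) f ≡ f (g x₀)
∑-tabulate-single {n = suc n} g f zero off =
  trans (cong (f (g zero) +_) (tail-zero (g ∘ suc) (λ x → off (suc x) (λ ()))))
        (+-identityʳ _)
  where
  tail-zero : ∀ {n} (h : Fin n → _) → (∀ x → f (h x) ≡ 0) → ∑ (tabulate h) f ≡ 0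
  tail-zero {zero}  h z = refl
  tail-zero {suc n} h z rewrite z zero = tail-zero (h ∘ suc) (z ∘ suc)
∑-tabulate-single {n = suc n} g f (suc x₀) off rewrite off zero (λ ()) =
  ∑-tabulate-single (g ∘ suc) f x₀ (λ x x≢ → off (suc x) (λ { refl → x≢ refl }))

∑-single : ∀ {n} (f : Fin n → ℕ) (x₀ : Fin n) →
  (∀ x → x ≢ x₀ → f x ≡ 0) → ∑ (allFin n) f ≡ f x₀
∑-single = ∑-tabulate-single id

∑-δ-unique : ∀ {n} {P : Fin n → Set} (P? : ∀ x → Dec (P x)) (x₀ : Fin n) → P x₀ →
  (∀ x → P x → x ≡ x₀) → ∑[ x ∈ allFin n ] δ (P? x) ≡ 1
∑-δ-unique P? x₀ px₀ uniq =
  trans (∑-single _ x₀ (λ x x≢ → δ-no (P? x) (x≢ ∘ uniq x))) (δ-yes (P? x₀) px₀)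

∑-δ-≟ : ∀ {n} (x₀ : Fin n) → ∑[ x ∈ allFin n ] δ (x ≟ x₀) ≡ 1
∑-δ-≟ x₀ = ∑-δ-unique (_≟ x₀) x₀ refl (λ _ eq → eq)

∑-applyUpTo : (g : ℕ → A) (n : ℕ) {f : A → ℕ} → ∑ (applyUpTo g n) f ≡ ∑[ l ∈ upTo n ] f (g l)
∑-applyUpTo g zero        = refl
∑-applyUpTo g (suc n) {f} = cong (f (g 0) +_)
  (trans (∑-applyUpTo (g ∘ suc) n) (sym (∑-applyUpTo suc n)))

∑-upTo-suc : ∀ n (f : ℕ → ℕ) → ∑ (upTo (suc n)) f ≡ f 0 + ∑ (upTo n) (f ∘ suc)
∑-upTo-suc n f = cong (f 0 +_) (∑-applyUpTo suc n)

∑-upTo-cong : ∀ n {f g : ℕ → ℕ} → (∀ l → l < n → f l ≡ g l) → ∑ (upTo n) f ≡ ∑ (upTo n) g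
∑-upTo-cong zero    eq = refl
∑-upTo-cong (suc n) {f} {g} eq = begin
  ∑ (upTo (suc n)) f            ≡⟨ ∑-upTo-suc n f ⟩
  f 0 + ∑ (upTo n) (f ∘ suc)    ≡⟨ cong₂ _+_ (eq 0 z<s) (∑-upTo-cong n (λ l l<n → eq (suc l) (s<s l<n))) ⟩
  g 0 + ∑ (upTo n) (g ∘ suc)    ≡⟨ ∑-upTo-suc n g ⟨
  ∑ (upTo (suc n)) g            ∎
  where open ≡-Reasoning

∑-upTo-single : ∀ n (f : ℕ → ℕ) {l₀} → l₀ < n →
  (∀ l → l < n → l ≢ l₀ → f l ≡ 0) → ∑ (upTo n) f ≡ f l₀
∑-upTo-single (suc n) f {zero} _ off = begin
  ∑ (upTo (suc n)) f         ≡⟨ ∑-upTo-suc n f ⟩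
  f 0 + ∑ (upTo n) (f ∘ suc) ≡⟨ cong (f 0 +_) (∑-upTo-cong n (λ l l<n → off (suc l) (s<s l<n) (λ ()))) ⟩
  f 0 + ∑ (upTo n) (λ _ → 0) ≡⟨ cong (f 0 +_) (∑-zero (upTo n) (λ _ → refl)) ⟩
  f 0 + 0                    ≡⟨ +-identityʳ _ ⟩
  f 0                        ∎
  where open ≡-Reasoning
∑-upTo-single (suc n) f {suc l₀} (s≤s l₀<n) off = begin
  ∑ (upTo (suc n)) f         ≡⟨ ∑-upTo-suc n f ⟩
  f 0 + ∑ (upTo n) (f ∘ suc) ≡⟨ cong (_+ ∑ (upTo n) (f ∘ suc)) (off 0 z<s (λ ())) ⟩
  ∑ (upTo n) (f ∘ suc)       ≡⟨ ∑-upTo-single n (f ∘ suc) l₀<n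
                                  (λ l l<n l≢ → off (suc l) (s<s l<n) (l≢ ∘ suc-injective)) ⟩
  f (suc l₀)                 ∎
  where open ≡-Reasoning

∑-upTo-snoc : ∀ n (f : ℕ → ℕ) → ∑ (upTo (suc n)) f ≡ ∑ (upTo n) f + f n
∑-upTo-snoc zero    f = +-identityʳ (f 0)
∑-upTo-snoc (suc n) f = begin
  ∑ (upTo (suc (suc n))) f                   ≡⟨ ∑-upTo-suc (suc n) f ⟩
  f 0 + ∑ (upTo (suc n)) (f ∘ suc)           ≡⟨ cong (f 0 +_) (∑-upTo-snoc n (f ∘ suc)) ⟩
  f 0 + (∑ (upTo n) (f ∘ suc) + f (suc n))   ≡⟨ +-assoc (f 0) _ _ ⟨
  (f 0 + ∑ (upTo n) (f ∘ suc)) + f (suc n)   ≡⟨ cong (_+ f (suc n)) (∑-upTo-suc n f) ⟨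
  ∑ (upTo (suc n)) f + f (suc n)             ∎
  where open ≡-Reasoning

-- Both sums arise from the one over `upTo (suc n)` by dropping an end term, and the two end terms
-- agree. It serves closed cycles, where `p m ≡ p 0`.
∑-upTo-rotate : ∀ n (f : ℕ → ℕ) → f n ≡ f 0 → ∑ (upTo n) (f ∘ suc) ≡ ∑ (upTo n) f
∑-upTo-rotate n f fn≡f0 = +-cancelˡ-≡ (f 0) _ _ (begin
  f 0 + ∑ (upTo n) (f ∘ suc) ≡⟨ ∑-upTo-suc n f ⟨
  ∑ (upTo (suc n)) f         ≡⟨ ∑-upTo-snoc n f ⟩
  ∑ (upTo n) f + f n         ≡⟨ +-comm _ (f n) ⟩
  f n + ∑ (upTo n) f         ≡⟨ cong (_+ ∑ (upTo n) f) fn≡f0 ⟩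
  f 0 + ∑ (upTo n) f         ∎)
  where open ≡-Reasoning

∑-≥-length : (xs : List A) {f : A → ℕ} → (∀ x → 1 ≤ f x) → length xs ≤ ∑ xs f
∑-≥-length []       1≤f = z≤n
∑-≥-length (x ∷ xs) 1≤f = +-mono-≤ (1≤f x) (∑-≥-length xs 1≤f)

-- A term above 1 would push the sum past the length, as no other term can make up for it by being
-- 0.
∑-≡-length : (xs : List A) {f : A → ℕ} → (∀ x → 1 ≤ f x) → ∑ xs f ≤ length xs →
  All (λ x → f x ≡ 1) xs
∑-≡-length []           1≤f ub = []
∑-≡-length (x ∷ xs) {f} 1≤f ub =
  ≤-antisym (+-cancelʳ-≤ (length xs) (f x) 1
              (≤-trans (+-monoʳ-≤ (f x) (∑-≥-length xs 1≤f)) ub)) (1≤f x)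
  ∷ ∑-≡-length xs 1≤f (+-cancelˡ-≤ 1 _ _ (≤-trans (+-monoˡ-≤ (∑ xs f) (1≤f x)) ub))

∈⇒1≤∑ : {xs : List A} {f : A → ℕ} {x : A} → x ∈ xs → 1 ≤ f x → 1 ≤ ∑ xs f
∈⇒1≤∑ (here refl) 1≤fx = ≤-trans 1≤fx (m≤m+n _ _)
∈⇒1≤∑ (there x∈)  1≤fx = ≤-trans (∈⇒1≤∑ x∈ 1≤fx) (m≤n+m _ _)

occurs : ∀ {n} → Fin n → List (Fin n) → ℕ
occurs v xs = ∑[ x ∈ xs ] δ (x ≟ v)

-- Double counting: the numbers of occurrences of all `v` add up to `length xs ≡ n`, and each is at
-- least 1. A closed walk of the right length is thus Hamiltonian as soon as it reaches every point.
occurs-pigeonhole : ∀ {n} (xs : List (Fin n)) → length xs ≡ n → (∀ v → v ∈ xs) →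
  ∀ v → occurs v xs ≡ 1
occurs-pigeonhole {n} xs len all∈ v = All.lookup ones (∈-allFin v)
  where
  open ≡-Reasoning
  total : ∑[ v ∈ allFin n ] occurs v xs ≡ length (allFin n)
  total = begin
    ∑[ v ∈ allFin n ] ∑[ x ∈ xs ] δ (x ≟ v) ≡⟨ ∑-swap (allFin n) xs _ ⟩
    ∑[ x ∈ xs ] ∑[ v ∈ allFin n ] δ (x ≟ v) ≡⟨ ∑-cong xs (λ x → ∑-δ-unique (x ≟_) x refl (λ _ → sym)) ⟩
    ∑[ x ∈ xs ] 1                           ≡⟨ ∑-one xs ⟩
    length xs                               ≡⟨ len ⟩
    n                                       ≡⟨ length-tabulate id ⟨
    length (allFin n)                       ∎
  ones : All (λ v → occurs v xs ≡ 1) (allFin n)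
  ones = ∑-≡-length (allFin n)
    (λ v → ∈⇒1≤∑ (all∈ v) (≤-reflexive (sym (δ-yes (v ≟ v) refl)))) (≤-reflexive total)

-- Edge counts and alternating cycles

-- For v ≡ w a loop at v would be counted twice.
hits : ∀ {n} → Fin n → Fin n → Fin n × Fin n → ℕ
hits v w (x , y) = δ (x ≟ v) * δ (y ≟ w) + δ (x ≟ w) * δ (y ≟ v)

module _ {A : Set} where

  zigzag : (p q : ℕ → A) (m : ℕ) → Vec A (m * 2)
  zigzag p q zero    = []
  zigzag p q (suc m) = p 0 ∷ q 0 ∷ zigzag (p ∘ suc) (q ∘ suc) m

  -- The last edge is `(q (m − 1) , p m)`, which closes the cycle only when `p m ≡ p 0`. With `p`
  -- and `q` defined on all of ℕ, no edge needs special treatment.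
  zigzagEdges : (p q : ℕ → A) (m : ℕ) → List (A × A)
  zigzagEdges p q zero    = []
  zigzagEdges p q (suc m) = (p 0 , q 0) ∷ (q 0 , p 1) ∷ zigzagEdges (p ∘ suc) (q ∘ suc) m

  cycEdges-zigzag : ∀ p q m → p m ≡ p 0 → cycEdges (toList (zigzag p q m)) ≡ zigzagEdges p q m
  cycEdges-zigzag p q zero    _   = refl
  cycEdges-zigzag p q (suc m) eq  rewrite sym eq = cong (_ ∷_) (path p q m)
    where
    path : ∀ p q m →
      zip (q 0 ∷ toList (zigzag (p ∘ suc) (q ∘ suc) m))
          (toList (zigzag (p ∘ suc) (q ∘ suc) m) ++ [ p (suc m) ])
      ≡ (q 0 , p 1) ∷ zigzagEdges (p ∘ suc) (q ∘ suc) m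
    path p q zero    = refl
    path p q (suc m) = cong (λ es → (q 0 , p 1) ∷ (p 1 , q 1) ∷ es) (path (p ∘ suc) (q ∘ suc) m)

  ∑-zigzag : ∀ p q m (f : A → ℕ) →
    ∑ (toList (zigzag p q m)) f ≡ ∑[ l ∈ upTo m ] (f (p l) + f (q l))
  ∑-zigzag p q zero    f = refl
  ∑-zigzag p q (suc m) f = begin
    f (p 0) + (f (q 0) + ∑ (toList (zigzag (p ∘ suc) (q ∘ suc) m)) f)
      ≡⟨ +-assoc (f (p 0)) _ _ ⟨
    (f (p 0) + f (q 0)) + ∑ (toList (zigzag (p ∘ suc) (q ∘ suc) m)) f
      ≡⟨ cong (f (p 0) + f (q 0) +_) (∑-zigzag (p ∘ suc) (q ∘ suc) m f) ⟩
    (f (p 0) + f (q 0)) + ∑[ l ∈ upTo m ] (f (p (suc l)) + f (q (suc l)))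
      ≡⟨ ∑-upTo-suc m _ ⟨
    ∑[ l ∈ upTo (suc m) ] (f (p l) + f (q l)) ∎
    where open ≡-Reasoning

  ∑-zigzagEdges : ∀ p q m (f : A × A → ℕ) →
    ∑ (zigzagEdges p q m) f ≡ ∑[ l ∈ upTo m ] (f (p l , q l) + f (q l , p (suc l)))
  ∑-zigzagEdges p q zero    f = refl
  ∑-zigzagEdges p q (suc m) f = begin
    f (p 0 , q 0) + (f (q 0 , p 1) + ∑ (zigzagEdges (p ∘ suc) (q ∘ suc) m) f)
      ≡⟨ +-assoc (f (p 0 , q 0)) _ _ ⟨
    (f (p 0 , q 0) + f (q 0 , p 1)) + ∑ (zigzagEdges (p ∘ suc) (q ∘ suc) m) f
      ≡⟨ cong (f (p 0 , q 0) + f (q 0 , p 1) +_) (∑-zigzagEdges (p ∘ suc) (q ∘ suc) m f) ⟩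
    (f (p 0 , q 0) + f (q 0 , p 1)) + ∑[ l ∈ upTo m ] (f (p (suc l) , q (suc l)) + f (q (suc l) , p (suc (suc l))))
      ≡⟨ ∑-upTo-suc m _ ⟨
    ∑[ l ∈ upTo (suc m) ] (f (p l , q l) + f (q l , p (suc l))) ∎
    where open ≡-Reasoning

  All-zigzagEdges : ∀ {P : A × A → Set} p q m → (∀ l → P (p l , q l)) → (∀ l → P (q l , p (suc l))) →
    All P (zigzagEdges p q m)
  All-zigzagEdges p q zero    even odd = []
  All-zigzagEdges p q (suc m) even odd =
    even 0 ∷ odd 0 ∷ All-zigzagEdges (p ∘ suc) (q ∘ suc) m (even ∘ suc) (odd ∘ suc)

  ∈-zigzag-p : ∀ p q m {l} → l < m → p l ∈ toList (zigzag p q m)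
  ∈-zigzag-p p q (suc m) {zero}  _         = here refl
  ∈-zigzag-p p q (suc m) {suc l} (s≤s l<m) = there (there (∈-zigzag-p (p ∘ suc) (q ∘ suc) m l<m))

  ∈-zigzag-q : ∀ p q m {l} → l < m → q l ∈ toList (zigzag p q m)
  ∈-zigzag-q p q (suc m) {zero}  _         = there (here refl)
  ∈-zigzag-q p q (suc m) {suc l} (s≤s l<m) = there (there (∈-zigzag-q (p ∘ suc) (q ∘ suc) m l<m))

-- If `w` is `φ v`, a pair `x , φ x` is the edge `vw` exactly when it contains `v`, and by the
-- covering hypothesis one pair does. Otherwise no pair of this form is `vw`.
∑-hits-matching : ∀ {n} (φ : Fin n → Fin n) → (∀ v → φ (φ v) ≡ v) → (p : ℕ → Fin n) (m : ℕ) →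
  (∀ v → ∑[ l ∈ upTo m ] (δ (p l ≟ v) + δ (φ (p l) ≟ v)) ≡ 1) →
  ∀ v w → ∑[ l ∈ upTo m ] hits v w (p l , φ (p l)) ≡ δ (φ v ≟ w)
∑-hits-matching φ φφ p m cover v w with φ v ≟ w
... | yes refl = trans (∑-cong (upTo m) edge) (cover v)
  where
  edge : ∀ l → hits v (φ v) (p l , φ (p l)) ≡ δ (p l ≟ v) + δ (φ (p l) ≟ v)
  edge l = cong₂ _+_
    (sym (δ-absorbˡ (p l ≟ v) (φ (p l) ≟ φ v) (cong φ)))
    (sym (δ-absorbʳ (p l ≟ φ v) (φ (p l) ≟ v) (λ eq → trans (sym (φφ (p l))) (cong φ eq))))
    where
    δ-absorbˡ : {P Q : Set} (d : Dec P) (e : Dec Q) → (P → Q) → δ d ≡ δ d * δ e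
    δ-absorbˡ d e f = δ-factor d d e (λ p → p , f p) (λ p _ → p)
    δ-absorbʳ : {P Q : Set} (d : Dec P) (e : Dec Q) → (Q → P) → δ e ≡ δ d * δ e
    δ-absorbʳ d e f = δ-factor e d e (λ q → f q , q) (λ _ q → q)
... | no φv≢w = ∑-zero (upTo m) edge
  where
  edge : ∀ l → hits v w (p l , φ (p l)) ≡ 0
  edge l = cong₂ _+_
    (trans (sym (δ-× (p l ≟ v) (φ (p l) ≟ w)))
      (δ-no ((p l ≟ v) ×-dec (φ (p l) ≟ w)) (λ { (refl , eq) → φv≢w eq })))
    (trans (sym (δ-× (p l ≟ w) (φ (p l) ≟ v)))
      (δ-no ((p l ≟ w) ×-dec (φ (p l) ≟ v)) (λ { (refl , refl) → φv≢w (φφ w) })))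

-- Residues modulo n

module Residues (n′ : ℕ) where

  open import Data.Integer public using (ℤ; +_; ∣_∣) renaming (_+_ to _⊕_; _-_ to _⊖_; _*_ to _⊗_; -_ to ⊝_)

  n : ℕ
  n = suc n′

  infix 4 _≋_
  infix 3 _by_
  -- A record rather than a bare existential, so that `a` and `b` can be inferred from a proof of
  -- congruence.
  record _≋_ (a b : ℤ) : Set where
    constructor _by_
    field
      quotient   : ℤ
      difference : a ⊖ b ≡ quotient ⊗ + n

  private variable
    a b c d e f : ℤ

  -- The working tool for congruences: the difference to be shown divisible is written as a sum of
  -- differences already known to be, and the ring solver checks the identity.
  ≋-sum : a ≋ b → c ≋ d → e ⊖ f ≡ (a ⊖ b) ⊕ (c ⊖ d) → e ≋ f
  ≋-sum (s by p) (t by q) eq = s ⊕ t by trans eq (trans (cong₂ _⊕_ p q) (distrib s t (+ n)))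
    where
    distrib : ∀ s t n → s ⊗ n ⊕ t ⊗ n ≡ (s ⊕ t) ⊗ n
    distrib = ℤ.solve-∀

  ≋-by : a ≋ b → e ⊖ f ≡ a ⊖ b → e ≋ f
  ≋-by (s by p) eq = s by trans eq p

  ≋-refl : a ≋ a
  ≋-refl {a} = + 0 by lemma a (+ n)
    where
    lemma : ∀ a n → a ⊖ a ≡ + 0 ⊗ n
    lemma = ℤ.solve-∀

  ≋-sym : a ≋ b → b ≋ a
  ≋-sym {a} {b} (s by p) = ⊝ s by trans (flip a b) (trans (cong ⊝_ p) (neg s (+ n)))
    where
    flip : ∀ a b → b ⊖ a ≡ ⊝ (a ⊖ b)
    flip = ℤ.solve-∀
    neg : ∀ s n → ⊝ (s ⊗ n) ≡ ⊝ s ⊗ n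
    neg = ℤ.solve-∀

  ≋-trans : a ≋ b → b ≋ c → a ≋ c
  ≋-trans {a} {b} {c} p q = ≋-sum p q (lemma a b c)
    where
    lemma : ∀ a b c → a ⊖ c ≡ (a ⊖ b) ⊕ (b ⊖ c)
    lemma = ℤ.solve-∀

  ≋-scale : ∀ k → a ≋ b → k ⊗ a ≋ k ⊗ b
  ≋-scale {a} {b} k (s by p) = k ⊗ s by trans (distrib k a b) (trans (cong (k ⊗_) p) (assoc k s (+ n)))
    where
    distrib : ∀ k a b → k ⊗ a ⊖ k ⊗ b ≡ k ⊗ (a ⊖ b)
    distrib = ℤ.solve-∀
    assoc : ∀ k s n → k ⊗ (s ⊗ n) ≡ k ⊗ s ⊗ n
    assoc = ℤ.solve-∀

  +n≋ : ∀ k a → a ⊕ k ⊗ + n ≋ a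
  +n≋ k a = k by lemma a (k ⊗ + n)
    where
    lemma : ∀ a b → a ⊕ b ⊖ a ≡ b
    lemma = ℤ.solve-∀

  ↑ : Fin n → ℤ
  ↑ x = + toℕ x

  abstract
    -- Kept abstract so that remainders never unfold; all that follows uses only the congruence
    -- `↑⟦_⟧`.
    ⟦_⟧ : ℤ → Fin n
    ⟦ a ⟧ = fromℕ< (n%ℕd<d a n)

    ↑⟦_⟧ : ∀ a → ↑ ⟦ a ⟧ ≋ a
    ↑⟦ a ⟧ = ≋-sym
      (a /ℕ n by trans (cong₂ _⊖_ (a≡a%ℕn+[a/ℕn]*n a n) (cong +_ (Fin.toℕ-fromℕ< (n%ℕd<d a n))))
                      (lemma (+ (a %ℕ n)) (a /ℕ n ⊗ + n)))
      where
      lemma : ∀ r m → r ⊕ m ⊖ r ≡ m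
      lemma = ℤ.solve-∀

  -- The distance between `k` and `l` is a multiple of `n` smaller than `n`, hence 0.
  ≋⇒≡ℕ : ∀ {k l} → k < n → l < n → + k ≋ + l → k ≡ l
  ≋⇒≡ℕ {k} {l} k<n l<n (t by eq) with ∣ + k ⊖ + l ∣ in ∣k-l∣
  ... | zero  = ℤ.+-injective (ℤ.i-j≡0⇒i≡j (+ k) (+ l) (ℤ.∣i∣≡0⇒i≡0 ∣k-l∣))
  ... | suc j = ⊥-elim (>⇒∤ {suc j} bound (divides ∣ t ∣ (trans (sym ∣k-l∣) (trans (cong ∣_∣ eq) (ℤ.abs-* t (+ n))))))
    where
    bound : suc j < n
    bound = subst (_< n) (trans (cong ∣_∣ (sym (ℤ.m-n≡m⊖n k l))) ∣k-l∣)
              (≤-<-trans (ℤ.∣m⊝n∣≤m⊔n k l) (⊔-lub k<n l<n))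

  ≋⇒≡ : ∀ {x y} → ↑ x ≋ ↑ y → x ≡ y
  ≋⇒≡ {x} {y} p = Fin.toℕ-injective (≋⇒≡ℕ (Fin.toℕ<n x) (Fin.toℕ<n y) p)

  ≋⇒⟦⟧≡ : ∀ {x} → a ≋ ↑ x → ⟦ a ⟧ ≡ x
  ≋⇒⟦⟧≡ {a} {x} p = ≋⇒≡ (≋-trans ↑⟦ a ⟧ p)

  ⟦⟧-cong : a ≋ b → ⟦ a ⟧ ≡ ⟦ b ⟧
  ⟦⟧-cong {a} {b} p = ≋⇒⟦⟧≡ (≋-trans p (≋-sym ↑⟦ b ⟧))

  ⟦⟧≡⇒≋ : ∀ {x} → ⟦ a ⟧ ≡ x → a ≋ ↑ x
  ⟦⟧≡⇒≋ {a} refl = ≋-sym ↑⟦ a ⟧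

  ≡⇒≋ : a ≡ b → a ≋ b
  ≡⇒≋ refl = ≋-refl

module OddResidues (s : ℕ) where

  open Residues (s + s) public

  n≋0 : + 1 ⊕ (+ s ⊕ + s) ≋ + 0
  n≋0 = + 1 by lemma (+ n)
    where
    lemma : ∀ n → n ⊖ + 0 ≡ + 1 ⊗ n
    lemma = ℤ.solve-∀

  -- The inverse of 2 modulo `2s + 1` is `s + 1`, because 2(s + 1) = (2s + 1) + 1.
  half : ℤ → ℤ
  half a = (+ 1 ⊕ + s) ⊗ a

  half-double : ∀ a → half (a ⊕ a) ≋ a
  half-double a = ≋-trans (≡⇒≋ (lemma (+ s) a)) (+n≋ a a)
    where
    lemma : ∀ s a → (+ 1 ⊕ s) ⊗ (a ⊕ a) ≡ a ⊕ a ⊗ (+ 1 ⊕ (s ⊕ s))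
    lemma = ℤ.solve-∀

  double-half : ∀ a → half a ⊕ half a ≋ a
  double-half a = ≋-trans (≡⇒≋ (lemma (+ s) a)) (half-double a)
    where
    lemma : ∀ s a → (+ 1 ⊕ s) ⊗ a ⊕ (+ 1 ⊕ s) ⊗ a ≡ (+ 1 ⊕ s) ⊗ (a ⊕ a)
    lemma = ℤ.solve-∀

  double-⟦half⟧ : ∀ a → ↑ ⟦ half a ⟧ ⊕ ↑ ⟦ half a ⟧ ≋ a
  double-⟦half⟧ a = ≋-trans (≋-sum ↑⟦ half a ⟧ ↑⟦ half a ⟧ (lemma (↑ ⟦ half a ⟧) (half a))) (double-half a)
    where
    lemma : ∀ c h → (c ⊕ c) ⊖ (h ⊕ h) ≡ (c ⊖ h) ⊕ (c ⊖ h)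
    lemma = ℤ.solve-∀

  double-cancel : ∀ {a b} → a ⊕ a ≋ b ⊕ b → a ≋ b
  double-cancel {a} {b} p =
    ≋-trans (≋-sym (half-double a)) (≋-trans (≋-scale (+ 1 ⊕ + s) p) (half-double b))

-- Cycle systems and 1-factorizations

-- Distinctness of the vertices is no field: it follows from `spanning` for a factor that contains
-- the cycle.
record Cycle (k n : ℕ) : Set where
  field
    vertices : Vec (Fin n) k
    proper   : All (λ e → proj₁ e ≢ proj₂ e) (cycEdges (toList vertices))

  edges : List (Fin n × Fin n)
  edges = cycEdges (toList vertices)

open Cycle

record CycleFactor (k n : ℕ) : Set where
  field
    members  : List (Cycle k n)
    spanning : ∀ v → ∑[ c ∈ members ] occurs v (toList (vertices c)) ≡ 1

open CycleFactor

record CycleSystem (k n : ℕ) : Set where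
  field
    factors : List (CycleFactor k n)
    twice   : ∀ {v w} → v ≢ w →
              ∑[ F ∈ factors ] ∑[ c ∈ members F ] ∑ (edges c) (hits v w) ≡ 2

record OneFactor (n : ℕ) : Set where
  field
    pairs    : List (Fin n × Fin n)
    proper   : All (λ e → proj₁ e ≢ proj₂ e) pairs
    spanning : ∀ v → ∑[ e ∈ pairs ] (δ (proj₁ e ≟ v) + δ (proj₂ e ≟ v)) ≡ 1

open OneFactor

-- `first` is singled out because the block construction fills its pairs differently from those of
-- the other 1-factors.
record OneFactorization (n : ℕ) : Set where
  field
    first : OneFactor n
    rest  : List (OneFactor n)
    once  : ∀ {v w} → v ≢ w → ∑[ F ∈ first ∷ rest ] ∑ (pairs F) (hits v w) ≡ 1

-- The points are ∞ = zero and the residues modulo 2s + 1 (shifted by suc). The 1-factor with centre c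
-- joins x to 2c − x and c to ∞; the 1-factors with centres c and c + 1/2 together form a Hamiltonian cycle.

module Rotational (s : ℕ) where

  open OddResidues s

  size : ℕ
  size = suc n

  reflect : Fin n → Fin size → Fin size
  reflect c zero = suc c
  reflect c (suc x) with x ≟ c
  ... | yes _ = zero
  ... | no _  = suc ⟦ ↑ c ⊕ ↑ c ⊖ ↑ x ⟧

  reflect-centre : ∀ c → reflect c (suc c) ≡ zero
  reflect-centre c with c ≟ c
  ... | yes _  = refl
  ... | no c≢c = ⊥-elim (c≢c refl)

  reflect-off : ∀ c {x} → x ≢ c → reflect c (suc x) ≡ suc ⟦ ↑ c ⊕ ↑ c ⊖ ↑ x ⟧
  reflect-off c {x} x≢c with x ≟ c
  ... | yes x≡c = ⊥-elim (x≢c x≡c)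
  ... | no _    = refl

  reflect-involutive : ∀ c v → reflect c (reflect c v) ≡ v
  reflect-involutive c zero = reflect-centre c
  reflect-involutive c (suc x) with x ≟ c
  ... | yes x≡c = cong suc (sym x≡c)
  ... | no x≢c  = trans (reflect-off c (λ y≡c → x≢c (≋⇒≡ (≋-sym (≋-by (⟦⟧≡⇒≋ y≡c) (flip (↑ c) (↑ x)))))))
                        (cong suc (≋⇒⟦⟧≡ (≋-by (≋-sym ↑⟦ ↑ c ⊕ ↑ c ⊖ ↑ x ⟧) (twice (↑ c) (↑ x) (↑ y)))))
    where
    y = ⟦ ↑ c ⊕ ↑ c ⊖ ↑ x ⟧
    flip : ∀ c x → c ⊖ x ≡ (c ⊕ c ⊖ x) ⊖ c
    flip = ℤ.solve-∀
    twice : ∀ c x y → (c ⊕ c ⊖ y) ⊖ x ≡ (c ⊕ c ⊖ x) ⊖ y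
    twice = ℤ.solve-∀

  -- A finite fixed point `x` other than `c` would satisfy 2x = 2c, and 2 is invertible modulo an
  -- odd number.
  reflect-≢ : ∀ c v → reflect c v ≢ v
  reflect-≢ c zero ()
  reflect-≢ c (suc x) eq with x ≟ c
  reflect-≢ c (suc x) () | yes _
  reflect-≢ c (suc x) eq | no x≢c =
    x≢c (≋⇒≡ (≋-sym (double-cancel (≋-by (⟦⟧≡⇒≋ (Fin.suc-injective eq)) (lemma (↑ c) (↑ x))))))
    where
    lemma : ∀ c x → (c ⊕ c) ⊖ (x ⊕ x) ≡ (c ⊕ c ⊖ x) ⊖ x
    lemma = ℤ.solve-∀

  -- The centre of the only 1-factor containing `vw`: the midpoint of two finite points, or the
  -- finite end of an edge at ∞.
  centre : (v w : Fin size) → v ≢ w → Fin n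
  centre zero    zero    v≢w = ⊥-elim (v≢w refl)
  centre zero    (suc y) _   = y
  centre (suc x) zero    _   = x
  centre (suc x) (suc y) _   = ⟦ half (↑ x ⊕ ↑ y) ⟧

  reflect-to : (v w : Fin size) (v≢w : v ≢ w) → reflect (centre v w v≢w) v ≡ w
  reflect-to zero  zero  v≢w = ⊥-elim (v≢w refl)
  reflect-to zero  (suc y) _   = refl
  reflect-to (suc x) zero  _   = reflect-centre x
  reflect-to (suc x) (suc y) v≢w = trans (reflect-off c x≢c)
      (cong suc (≋⇒⟦⟧≡ (≋-by (double-⟦half⟧ (↑ x ⊕ ↑ y)) (lemma (↑ c) (↑ x) (↑ y)))))
    where
    c = ⟦ half (↑ x ⊕ ↑ y) ⟧
    lemma : ∀ c x y → (c ⊕ c ⊖ x) ⊖ y ≡ (c ⊕ c) ⊖ (x ⊕ y)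
    lemma = ℤ.solve-∀
    lemma′ : ∀ c x y → x ⊖ y ≡ (c ⊕ c ⊖ (x ⊕ y)) ⊕ (x ⊖ c) ⊕ (x ⊖ c)
    lemma′ = ℤ.solve-∀
    -- If `x` were the midpoint of `x` and `y`, then `y` would equal `x`.
    x≢c : x ≢ c
    x≢c x≡c = v≢w (cong suc (≋⇒≡ (≋-by (double-⟦half⟧ (↑ x ⊕ ↑ y))
      (trans (lemma′ (↑ c) (↑ x) (↑ y)) (cancel (cong ↑ x≡c))))))
      where
      cancel : ∀ {x c b} → x ≡ c → b ⊕ (x ⊖ c) ⊕ (x ⊖ c) ≡ b
      cancel {x} {_} {b} refl = zeros x b
        where
        zeros : ∀ x b → b ⊕ (x ⊖ x) ⊕ (x ⊖ x) ≡ b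
        zeros = ℤ.solve-∀

  reflect-to-∞ : ∀ c x → reflect c (suc x) ≡ zero → c ≡ x
  reflect-to-∞ c x eq with x ≟ c
  reflect-to-∞ c x eq | yes x≡c = sym x≡c
  reflect-to-∞ c x () | no _

  reflect-to-finite : ∀ c x y → reflect c (suc x) ≡ suc y → ↑ c ⊕ ↑ c ≋ ↑ x ⊕ ↑ y
  reflect-to-finite c x y eq with x ≟ c
  reflect-to-finite c x y () | yes _
  reflect-to-finite c x y eq | no _ =
    ≋-by (⟦⟧≡⇒≋ (Fin.suc-injective eq)) (lemma (↑ c) (↑ x) (↑ y))
    where
    lemma : ∀ c x y → (c ⊕ c) ⊖ (x ⊕ y) ≡ (c ⊕ c ⊖ x) ⊖ y
    lemma = ℤ.solve-∀

  reflect-unique : (v w : Fin size) (v≢w : v ≢ w) (c : Fin n) → reflect c v ≡ w → c ≡ centre v w v≢w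
  reflect-unique zero    zero    v≢w c eq = ⊥-elim (v≢w refl)
  reflect-unique zero    (suc y) v≢w c eq = Fin.suc-injective eq
  reflect-unique (suc x) zero    v≢w c eq = reflect-to-∞ c x eq
  reflect-unique (suc x) (suc y) v≢w c eq =
    ≋⇒≡ (double-cancel (≋-trans (reflect-to-finite c x y eq) (≋-sym (double-⟦half⟧ (↑ x ⊕ ↑ y)))))

  ∑-reflect : ∀ {v w} → v ≢ w → ∑[ c ∈ allFin n ] δ (reflect c v ≟ w) ≡ 1
  ∑-reflect {v} {w} v≢w =
    ∑-δ-unique (λ c → reflect c v ≟ w) (centre v w v≢w) (reflect-to v w v≢w) (reflect-unique v w v≢w)

  -- `1 + s` is the residue 1/2. Reflecting in `c` and then in `c + 1/2` is translation by 1, which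
  -- drives the walk below.
  next : Fin n → Fin n
  next c = ⟦ ↑ c ⊕ (+ 1 ⊕ + s) ⟧

  ∑-reflect-next : ∀ {v w} → v ≢ w → ∑[ c ∈ allFin n ] δ (reflect (next c) v ≟ w) ≡ 1
  ∑-reflect-next {v} {w} v≢w = ∑-δ-unique (λ c → reflect (next c) v ≟ w) ⟦ ↑ r ⊖ (+ 1 ⊕ + s) ⟧
      (trans (cong (λ c → reflect c v) (≋⇒⟦⟧≡
               (≋-by ↑⟦ ↑ r ⊖ (+ 1 ⊕ + s) ⟧ (lemma (↑ ⟦ ↑ r ⊖ (+ 1 ⊕ + s) ⟧) (↑ r) (+ 1 ⊕ + s))))) (reflect-to v w v≢w))
      (λ c eq → sym (≋⇒⟦⟧≡
               (≋-by (≋-sym (⟦⟧≡⇒≋ (reflect-unique v w v≢w (next c) eq))) (lemma′ (↑ c) (↑ r) (+ 1 ⊕ + s)))))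
    where
    r = centre v w v≢w
    lemma : ∀ a r h → (a ⊕ h) ⊖ r ≡ a ⊖ (r ⊖ h)
    lemma = ℤ.solve-∀
    lemma′ : ∀ c r h → (r ⊖ h) ⊖ c ≡ r ⊖ (c ⊕ h)
    lemma′ = ℤ.solve-∀

  module _ (c : Fin n) where

    mutual
      -- A walk from ∞ that follows the two 1-factors in turn. Defined by the reflections, it has
      -- each edge in the right 1-factor by construction; explicit positions are needed only to see
      -- that it closes and reaches every point.
      p : ℕ → Fin size
      p zero    = zero
      p (suc l) = reflect (next c) (q l)

      q : ℕ → Fin size
      q l = reflect c (p l)

    private
      s<n : s < n
      s<n = s≤s (m≤m+n s s)

      small : ∀ {l} → l ≤ s → l < n
      small l≤s = ≤-<-trans l≤s s<n

      q-step : ∀ l → l < n → l ≢ 0 → reflect c (suc ⟦ ↑ c ⊕ + l ⟧) ≡ suc ⟦ ↑ c ⊖ + l ⟧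
      q-step l l<n l≢0 = trans
        (reflect-off c (λ eq → l≢0 (≋⇒≡ℕ l<n z<s (≋-by (⟦⟧≡⇒≋ eq) (off (↑ c) (+ l))))))
        (cong suc (⟦⟧-cong (≋-by (≋-sym ↑⟦ ↑ c ⊕ + l ⟧) (value (↑ c) (+ l) (↑ ⟦ ↑ c ⊕ + l ⟧)))))
        where
        off : ∀ c l → l ⊖ + 0 ≡ (c ⊕ l) ⊖ c
        off = ℤ.solve-∀
        value : ∀ c l x → (c ⊕ c ⊖ x) ⊖ (c ⊖ l) ≡ (c ⊕ l) ⊖ x
        value = ℤ.solve-∀

      p-step : ∀ l → l < s → reflect (next c) (suc ⟦ ↑ c ⊖ + l ⟧) ≡ suc ⟦ ↑ c ⊕ + suc l ⟧
      p-step l l<s = trans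
        (reflect-off (next c) (λ eq → <⇒≢ l<s (≋⇒≡ℕ (small (<⇒≤ l<s)) s<n (off eq))))
        (cong suc (⟦⟧-cong value))
        where
        x = ⟦ ↑ c ⊖ + l ⟧
        off₁ : ∀ c l s → l ⊖ s ≡ ((c ⊕ (+ 1 ⊕ s)) ⊖ (c ⊖ l)) ⊕ (+ 0 ⊖ (+ 1 ⊕ (s ⊕ s)))
        off₁ = ℤ.solve-∀
        off : x ≡ next c → + l ≋ + s
        off eq = ≋-sum (≋-trans (≋-sym ↑⟦ ↑ c ⊕ (+ 1 ⊕ + s) ⟧) (≋-trans (≡⇒≋ (cong ↑ (sym eq))) ↑⟦ ↑ c ⊖ + l ⟧))
                       (≋-sym n≋0) (off₁ (↑ c) (+ l) (+ s))
        value₁ : ∀ N x h → (N ⊕ N ⊖ x) ⊖ (h ⊕ h ⊖ x) ≡ (N ⊖ h) ⊕ (N ⊖ h)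
        value₁ = ℤ.solve-∀
        value₂ : ∀ c x s l → ((c ⊕ (+ 1 ⊕ s)) ⊕ (c ⊕ (+ 1 ⊕ s)) ⊖ x) ⊖ (c ⊕ (+ 1 ⊕ l)) ≡ ((c ⊖ l) ⊖ x) ⊕ ((+ 1 ⊕ (s ⊕ s)) ⊖ + 0)
        value₂ = ℤ.solve-∀
        value : ↑ (next c) ⊕ ↑ (next c) ⊖ ↑ x ≋ ↑ c ⊕ (+ 1 ⊕ + l)
        value = ≋-trans
          (≋-sum ↑⟦ ↑ c ⊕ (+ 1 ⊕ + s) ⟧ ↑⟦ ↑ c ⊕ (+ 1 ⊕ + s) ⟧ (value₁ (↑ (next c)) (↑ x) (↑ c ⊕ (+ 1 ⊕ + s))))
          (≋-sum (≋-sym ↑⟦ ↑ c ⊖ + l ⟧) n≋0 (value₂ (↑ c) (↑ x) (+ s) (+ l)))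

    -- The walk is ∞, c, c + 1, c - 1, c + 2, c - 2, ..., Walecki's zigzag. The formula for `p`
    -- stops before `l = s` because c - s is the centre `next c`, whose partner is ∞.
    q-formula : ∀ l → l ≤ s → q l ≡ suc ⟦ ↑ c ⊖ + l ⟧
    p-formula : ∀ l → l < s → p (suc l) ≡ suc ⟦ ↑ c ⊕ + suc l ⟧
    q-formula zero    _   = cong suc (sym (≋⇒⟦⟧≡ (≡⇒≋ (lemma (↑ c)))))
      where
      lemma : ∀ c → c ⊖ + 0 ≡ c
      lemma = ℤ.solve-∀
    q-formula (suc l) l<s = trans (cong (reflect c) (p-formula l l<s)) (q-step (suc l) (small l<s) λ ())
    p-formula l l<s = trans (cong (reflect (next c)) (q-formula l (<⇒≤ l<s))) (p-step l l<s)

    -- The point reached last is c - s = c + s + 1, the centre of the second 1-factor, so the next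
    -- step leads back to ∞.
    p-closes : p (suc s) ≡ p 0
    p-closes = trans (cong (reflect (next c)) (trans (q-formula s ≤-refl) (cong suc end)))
                     (reflect-centre (next c))
      where
      lemma : ∀ c s → (c ⊖ s) ⊖ (c ⊕ (+ 1 ⊕ s)) ≡ + 0 ⊖ (+ 1 ⊕ (s ⊕ s))
      lemma = ℤ.solve-∀
      end : ⟦ ↑ c ⊖ + s ⟧ ≡ next c
      end = ⟦⟧-cong (≋-by (≋-sym n≋0) (lemma (↑ c) (+ s)))

    -- Write x = c + t with 0 ≤ t ≤ 2s. For t = 0 it is `q 0`, for 1 ≤ t ≤ s it is `p t`, and for
    -- larger t it is c - (n - t), that is `q (n − t)`. After the match the number t appears as
    -- `suc t`.
    visits : ∀ v → v ∈ toList (zigzag p q (suc s))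
    visits zero    = ∈-zigzag-p p q (suc s) z<s
    visits (suc x) with toℕ ⟦ ↑ x ⊖ ↑ c ⟧ in toℕt
    ... | zero  = subst (_∈ toList (zigzag p q (suc s))) (cong suc (≋⇒≡ (≋-by (≋-trans (≡⇒≋ (cong +_ (sym toℕt))) ↑⟦ ↑ x ⊖ ↑ c ⟧) (lemma (↑ x) (↑ c)))))
                    (∈-zigzag-q p q (suc s) z<s)
      where
      lemma : ∀ x c → c ⊖ x ≡ + 0 ⊖ (x ⊖ c)
      lemma = ℤ.solve-∀
    ... | suc t with t <? s
    ... | yes t<s = subst (_∈ toList (zigzag p q (suc s))) (trans (p-formula t t<s) (cong suc (≋⇒⟦⟧≡
                      (≋-by (≋-trans (≡⇒≋ (cong +_ (sym toℕt))) ↑⟦ ↑ x ⊖ ↑ c ⟧) (lemma (↑ x) (↑ c) (+ suc t))))))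
                      (∈-zigzag-p p q (suc s) (s<s t<s))
      where
      lemma : ∀ x c t → c ⊕ t ⊖ x ≡ t ⊖ (x ⊖ c)
      lemma = ℤ.solve-∀
    ... | no t≮s = subst (_∈ toList (zigzag p q (suc s))) (trans (q-formula l l≤s) (cong suc (≋⇒⟦⟧≡
                     (≋-sum (≋-trans (≡⇒≋ (cong +_ (sym toℕt))) ↑⟦ ↑ x ⊖ ↑ c ⟧) (≋-sym n≋0)
                        (trans (lemma (↑ x) (↑ c) (+ suc t) (+ l)) (cong (λ k → (+ suc t ⊖ (↑ x ⊖ ↑ c)) ⊕ (+ 0 ⊖ + k)) t+l≡n))))))
                     (∈-zigzag-q p q (suc s) (s≤s l≤s))
      where
      l : ℕ
      l = (s + s) ∸ t
      l≤s : l ≤ s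
      l≤s = ≤-trans (∸-monoʳ-≤ (s + s) (≮⇒≥ t≮s)) (≤-reflexive (m+n∸m≡n s s))
      t+l≡n : suc t + l ≡ n
      t+l≡n = cong suc (m+[n∸m]≡n (<⇒≤ (s≤s⁻¹ (subst (_< n) toℕt (Fin.toℕ<n ⟦ ↑ x ⊖ ↑ c ⟧)))))
      lemma : ∀ x c t l → c ⊖ l ⊖ x ≡ (t ⊖ (x ⊖ c)) ⊕ (+ 0 ⊖ (t ⊕ l))
      lemma = ℤ.solve-∀

    private
      size≡ : suc s * 2 ≡ size
      size≡ = cong (λ j → suc (suc j)) (trans (*-comm s 2) (cong (_+_ s) (+-identityʳ s)))

    cover : ∀ v → occurs v (toList (zigzag p q (suc s))) ≡ 1
    cover = occurs-pigeonhole (toList (zigzag p q (suc s))) (trans (length-toList (zigzag p q (suc s))) size≡) visits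

    coverPairs : ∀ v → ∑[ l ∈ upTo (suc s) ] (δ (p l ≟ v) + δ (q l ≟ v)) ≡ 1
    coverPairs v = trans (sym (∑-zigzag p q (suc s) (λ x → δ (x ≟ v)))) (cover v)

    -- Shifting `p` by one only rotates its values around the closed walk, so the odd edges form a
    -- perfect matching as well.
    coverPairs′ : ∀ v → ∑[ l ∈ upTo (suc s) ] (δ (q l ≟ v) + δ (p (suc l) ≟ v)) ≡ 1
    coverPairs′ v = begin
      ∑[ l ∈ upTo (suc s) ] (δ (q l ≟ v) + δ (p (suc l) ≟ v))
        ≡⟨ ∑-+ (upTo (suc s)) (λ l → δ (q l ≟ v)) (λ l → δ (p (suc l) ≟ v)) ⟩
      ∑[ l ∈ upTo (suc s) ] δ (q l ≟ v) + ∑[ l ∈ upTo (suc s) ] δ (p (suc l) ≟ v)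
        ≡⟨ cong (_+_ (∑[ l ∈ upTo (suc s) ] δ (q l ≟ v)))
             (∑-upTo-rotate (suc s) (λ l → δ (p l ≟ v)) (cong (λ x → δ (x ≟ v)) p-closes)) ⟩
      ∑[ l ∈ upTo (suc s) ] δ (q l ≟ v) + ∑[ l ∈ upTo (suc s) ] δ (p l ≟ v)
        ≡⟨ +-comm (∑[ l ∈ upTo (suc s) ] δ (q l ≟ v)) _ ⟩
      ∑[ l ∈ upTo (suc s) ] δ (p l ≟ v) + ∑[ l ∈ upTo (suc s) ] δ (q l ≟ v)
        ≡⟨ ∑-+ (upTo (suc s)) (λ l → δ (p l ≟ v)) (λ l → δ (q l ≟ v)) ⟨
      ∑[ l ∈ upTo (suc s) ] (δ (p l ≟ v) + δ (q l ≟ v))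
        ≡⟨ coverPairs v ⟩
      1 ∎
      where open ≡-Reasoning

    hamiltonian : CycleFactor (suc s * 2) size
    hamiltonian = record
      { members  = [ record { vertices = zigzag p q (suc s)
                            ; proper   = subst (All _) (sym (cycEdges-zigzag p q (suc s) p-closes))
                                (All-zigzagEdges p q (suc s) (λ l eq → reflect-≢ c (p l) (sym eq))
                                                             (λ l eq → reflect-≢ (next c) (q l) (sym eq))) } ]
      ; spanning = λ v → trans (+-identityʳ _) (cover v)
      }

    matching : OneFactor size
    matching = record
      { pairs    = map (λ l → p l , q l) (upTo (suc s))
      ; proper   = All.map⁺ (All.applyUpTo⁺₂ id (suc s) (λ l eq → reflect-≢ c (p l) (sym eq)))
      ; spanning = λ v → trans (∑-map (λ l → p l , q l) (upTo (suc s))) (coverPairs v)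
      }

    ∑-hits-even : ∀ v w → ∑[ l ∈ upTo (suc s) ] hits v w (p l , q l) ≡ δ (reflect c v ≟ w)
    ∑-hits-even = ∑-hits-matching (reflect c) (reflect-involutive c) p (suc s) coverPairs

    ∑-hits-odd : ∀ v w → ∑[ l ∈ upTo (suc s) ] hits v w (q l , p (suc l)) ≡ δ (reflect (next c) v ≟ w)
    ∑-hits-odd = ∑-hits-matching (reflect (next c)) (reflect-involutive (next c)) q (suc s) coverPairs′

    ∑-hits-hamiltonian : ∀ v w → ∑[ d ∈ members hamiltonian ] ∑ (edges d) (hits v w)
                               ≡ δ (reflect c v ≟ w) + δ (reflect (next c) v ≟ w)
    ∑-hits-hamiltonian v w = begin
      ∑ (cycEdges (toList (zigzag p q (suc s)))) (hits v w) + 0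
        ≡⟨ +-identityʳ _ ⟩
      ∑ (cycEdges (toList (zigzag p q (suc s)))) (hits v w)
        ≡⟨ cong (λ es → ∑ es (hits v w)) (cycEdges-zigzag p q (suc s) p-closes) ⟩
      ∑ (zigzagEdges p q (suc s)) (hits v w)
        ≡⟨ ∑-zigzagEdges p q (suc s) (hits v w) ⟩
      ∑[ l ∈ upTo (suc s) ] (hits v w (p l , q l) + hits v w (q l , p (suc l)))
        ≡⟨ ∑-+ (upTo (suc s)) (λ l → hits v w (p l , q l)) (λ l → hits v w (q l , p (suc l))) ⟩
      ∑[ l ∈ upTo (suc s) ] hits v w (p l , q l) + ∑[ l ∈ upTo (suc s) ] hits v w (q l , p (suc l))
        ≡⟨ cong₂ _+_ (∑-hits-even v w) (∑-hits-odd v w) ⟩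
      δ (reflect c v ≟ w) + δ (reflect (next c) v ≟ w) ∎
      where open ≡-Reasoning

  -- Each 1-factor is used twice: as the even edges of the cycle at its own centre and as the odd
  -- edges of the cycle whose centre lies 1/2 before it.
  hamiltonianSystem : CycleSystem (suc s * 2) size
  hamiltonianSystem = record
    { factors = map hamiltonian (allFin n)
    ; twice   = λ {v} {w} v≢w → begin
        ∑[ F ∈ map hamiltonian (allFin n) ] ∑[ d ∈ members F ] ∑ (edges d) (hits v w)
          ≡⟨ ∑-map hamiltonian (allFin n) ⟩
        ∑[ c ∈ allFin n ] ∑[ d ∈ members (hamiltonian c) ] ∑ (edges d) (hits v w)
          ≡⟨ ∑-cong (allFin n) (λ c → ∑-hits-hamiltonian c v w) ⟩
        ∑[ c ∈ allFin n ] (δ (reflect c v ≟ w) + δ (reflect (next c) v ≟ w))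
          ≡⟨ ∑-+ (allFin n) (λ c → δ (reflect c v ≟ w)) (λ c → δ (reflect (next c) v ≟ w)) ⟩
        ∑[ c ∈ allFin n ] δ (reflect c v ≟ w) + ∑[ c ∈ allFin n ] δ (reflect (next c) v ≟ w)
          ≡⟨ cong₂ _+_ (∑-reflect v≢w) (∑-reflect-next v≢w) ⟩
        2 ∎
    }
    where open ≡-Reasoning

  oneFactorization : OneFactorization size
  oneFactorization = record
    { first = matching zero
    ; rest  = map matching (tabulate suc)
    ; once  = λ {v} {w} v≢w → begin
        ∑[ F ∈ map matching (allFin n) ] ∑ (pairs F) (hits v w)
          ≡⟨ ∑-map matching (allFin n) ⟩
        ∑[ c ∈ allFin n ] ∑ (pairs (matching c)) (hits v w)
          ≡⟨ ∑-cong (allFin n) (λ c → trans (∑-map (λ l → p c l , q c l) (upTo (suc s))) (∑-hits-even c v w)) ⟩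
        ∑[ c ∈ allFin n ] δ (reflect c v ≟ w)
          ≡⟨ ∑-reflect v≢w ⟩
        1 ∎
    }
    where open ≡-Reasoning

open CycleSystem
open OneFactorization

-- `All.reduce` turns the pairs of a 1-factor, each with its proof that the ends differ, into
-- cycles; sums over these cycles become sums over the pairs.
∑-reduce : {A B : Set} {P : A → Set} {xs : List A} (f : ∀ {x} → P x → B) (ps : All P xs)
  {g : B → ℕ} {g′ : A → ℕ} → (∀ {x} (p : P x) → g (f p) ≡ g′ x) →
  ∑ (All.reduce f ps) g ≡ ∑ xs g′
∑-reduce f []       eq = refl
∑-reduce f (p ∷ ps) eq = cong₂ _+_ (eq p) (∑-reduce f ps eq)

cycEdges-map : {A B : Set} (f : A → B) (xs : List A) →
  cycEdges (map f xs) ≡ map (Product.map f f) (cycEdges xs)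
cycEdges-map f []       = refl
cycEdges-map f (x ∷ xs) = begin
  zip (map f (x ∷ xs)) (map f xs ++ [ f x ])          ≡⟨ cong (zip (map f (x ∷ xs))) (map-++ f xs [ x ]) ⟨
  zip (map f (x ∷ xs)) (map f (xs ++ [ x ]))          ≡⟨ zipWith-map _,_ f f (x ∷ xs) (xs ++ [ x ]) ⟩
  zipWith (λ y z → f y , f z) (x ∷ xs) (xs ++ [ x ]) ≡⟨ map-zipWith _,_ (Product.map f f) (x ∷ xs) (xs ++ [ x ]) ⟨
  map (Product.map f f) (zip (x ∷ xs) (xs ++ [ x ]))  ∎
  where open ≡-Reasoning

hits-flip : ∀ {n} (v w x y : Fin n) → hits v w (x , y) ≡ hits v w (y , x)
hits-flip v w x y = lemma (δ (x ≟ v)) (δ (y ≟ w)) (δ (x ≟ w)) (δ (y ≟ v))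
  where
  lemma : ∀ a b c d → a * b + c * d ≡ d * c + b * a
  lemma = solve-∀

δδ-disjoint : ∀ {n} (v : Fin n) {x y} → x ≢ y → δ (x ≟ v) * δ (y ≟ v) ≡ 0
δδ-disjoint v {x} {y} x≢y = trans (sym (δ-× (x ≟ v) (y ≟ v)))
  (δ-no ((x ≟ v) ×-dec (y ≟ v)) (λ { (refl , refl) → x≢y refl }))

hits-loop : ∀ {n} (v : Fin n) {x y} → x ≢ y → hits v v (x , y) ≡ 0
hits-loop v x≢y = cong₂ _+_ (δδ-disjoint v x≢y) (δδ-disjoint v x≢y)

δδ-distinct : ∀ {n} {v w : Fin n} (x : Fin n) → v ≢ w → δ (x ≟ v) * δ (x ≟ w) ≡ 0
δδ-distinct {v = v} {w} x v≢w = trans (sym (δ-× (x ≟ v) (x ≟ w)))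
  (δ-no ((x ≟ v) ×-dec (x ≟ w)) (λ { (refl , refl) → v≢w refl }))

δδ-same : ∀ {n} (x v : Fin n) → δ (x ≟ v) * δ (x ≟ v) ≡ δ (x ≟ v)
δδ-same x v with x ≟ v
... | yes _ = refl
... | no _  = refl

-- Points in blocks: `combine A i` is position `i` of block `A`

module _ {N m : ℕ} where

  δ-combine : (A C : Fin N) (i h : Fin m) → δ (combine A i ≟ combine C h) ≡ δ (A ≟ C) * δ (i ≟ h)
  δ-combine A C i h = δ-factor (combine A i ≟ combine C h) (A ≟ C) (i ≟ h)
    (Fin.combine-injective A i C h) (λ { refl refl → refl })

  hits-combine : (C D : Fin N) (h h′ : Fin m) (A B : Fin N) (i j : Fin m) →
    hits (combine C h) (combine D h′) (combine A i , combine B j) ≡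
    (δ (A ≟ C) * δ (B ≟ D)) * (δ (i ≟ h) * δ (j ≟ h′)) + (δ (A ≟ D) * δ (B ≟ C)) * (δ (i ≟ h′) * δ (j ≟ h))
  hits-combine C D h h′ A B i j = trans
    (cong₂ _+_ (cong₂ _*_ (δ-combine A C i h) (δ-combine B D j h′))
               (cong₂ _*_ (δ-combine A D i h′) (δ-combine B C j h)))
    (lemma (δ (A ≟ C)) (δ (i ≟ h)) (δ (B ≟ D)) (δ (j ≟ h′)) (δ (A ≟ D)) (δ (i ≟ h′)) (δ (B ≟ C)) (δ (j ≟ h)))
    where
    lemma : ∀ a i b j a′ i′ b′ j′ → (a * i) * (b * j) + (a′ * i′) * (b′ * j′) ≡ (a * b) * (i * j) + (a′ * b′) * (i′ * j′)
    lemma = solve-∀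

  combine-elim : (P : Fin (N * m) → Set) → ((C : Fin N) (h : Fin m) → P (combine C h)) → ∀ v → P v
  combine-elim P f v = subst P (Fin.combine-remQuot {N} m v) (f _ _)

  -- For fixed `l` the position `j l d` takes each value once as `d` varies, and `i l` takes each
  -- value once as `l` varies. So the edges form one K_{m,m} between the blocks `A` and `B`.
  ∑-hits-join : (A B C D : Fin N) (h h′ : Fin m) (i : ℕ → Fin m) (j : ℕ → Fin m → Fin m) →
    (∀ h → ∑[ l ∈ upTo m ] δ (i l ≟ h) ≡ 1) → (∀ l h → ∑[ d ∈ allFin m ] δ (j l d ≟ h) ≡ 1) →
    ∑[ d ∈ allFin m ] ∑[ l ∈ upTo m ] hits (combine C h) (combine D h′) (combine A (i l) , combine B (j l d))
      ≡ hits C D (A , B)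
  ∑-hits-join A B C D h h′ i j Σi Σj = begin
    ∑[ d ∈ allFin m ] ∑[ l ∈ upTo m ] hits (combine C h) (combine D h′) (combine A (i l) , combine B (j l d))
      ≡⟨ ∑-swap (allFin m) (upTo m) _ ⟩
    ∑[ l ∈ upTo m ] ∑[ d ∈ allFin m ] hits (combine C h) (combine D h′) (combine A (i l) , combine B (j l d))
      ≡⟨ ∑-cong (upTo m) inner ⟩
    ∑[ l ∈ upTo m ] (X * δ (i l ≟ h) + Y * δ (i l ≟ h′))
      ≡⟨ ∑-+ (upTo m) (λ l → X * δ (i l ≟ h)) (λ l → Y * δ (i l ≟ h′)) ⟩
    ∑[ l ∈ upTo m ] (X * δ (i l ≟ h)) + ∑[ l ∈ upTo m ] (Y * δ (i l ≟ h′))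
      ≡⟨ cong₂ _+_ (trans (∑-*ˡ (upTo m) X _) (cong (X *_) (Σi h))) (trans (∑-*ˡ (upTo m) Y _) (cong (Y *_) (Σi h′))) ⟩
    X * 1 + Y * 1
      ≡⟨ cong₂ _+_ (*-identityʳ X) (*-identityʳ Y) ⟩
    X + Y ∎
    where
    open ≡-Reasoning
    X = δ (A ≟ C) * δ (B ≟ D)
    Y = δ (A ≟ D) * δ (B ≟ C)
    half : ∀ l Z (x y : Fin m) → ∑[ d ∈ allFin m ] (Z * (δ (i l ≟ x) * δ (j l d ≟ y))) ≡ Z * δ (i l ≟ x)
    half l Z x y = begin
      ∑[ d ∈ allFin m ] (Z * (δ (i l ≟ x) * δ (j l d ≟ y))) ≡⟨ ∑-*ˡ (allFin m) Z (λ d → δ (i l ≟ x) * δ (j l d ≟ y)) ⟩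
      Z * ∑[ d ∈ allFin m ] (δ (i l ≟ x) * δ (j l d ≟ y))   ≡⟨ cong (Z *_) (∑-*ˡ (allFin m) (δ (i l ≟ x)) (λ d → δ (j l d ≟ y))) ⟩
      Z * (δ (i l ≟ x) * ∑[ d ∈ allFin m ] δ (j l d ≟ y))   ≡⟨ cong (λ k → Z * (δ (i l ≟ x) * k)) (Σj l y) ⟩
      Z * (δ (i l ≟ x) * 1)                                 ≡⟨ cong (Z *_) (*-identityʳ _) ⟩
      Z * δ (i l ≟ x)                                       ∎
    inner : ∀ l → ∑[ d ∈ allFin m ] hits (combine C h) (combine D h′) (combine A (i l) , combine B (j l d))
                ≡ X * δ (i l ≟ h) + Y * δ (i l ≟ h′)
    inner l = begin
      ∑[ d ∈ allFin m ] hits (combine C h) (combine D h′) (combine A (i l) , combine B (j l d))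
        ≡⟨ ∑-cong (allFin m) (λ d → hits-combine C D h h′ A B (i l) (j l d)) ⟩
      ∑[ d ∈ allFin m ] (X * (δ (i l ≟ h) * δ (j l d ≟ h′)) + Y * (δ (i l ≟ h′) * δ (j l d ≟ h)))
        ≡⟨ ∑-+ (allFin m) (λ d → X * (δ (i l ≟ h) * δ (j l d ≟ h′))) (λ d → Y * (δ (i l ≟ h′) * δ (j l d ≟ h))) ⟩
      ∑[ d ∈ allFin m ] (X * (δ (i l ≟ h) * δ (j l d ≟ h′))) + ∑[ d ∈ allFin m ] (Y * (δ (i l ≟ h′) * δ (j l d ≟ h)))
        ≡⟨ cong₂ _+_ (half l X h h′) (half l Y h′ h) ⟩
      X * δ (i l ≟ h) + Y * δ (i l ≟ h′) ∎

-- 2K_{m,m} between the blocks A and B: for each d the cycle (A , 0) (B , d) (A , 1) (B , 1 + d) …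

module Join {N : ℕ} (s : ℕ) where

  open Residues s renaming (n to m)

  pA : Fin N → ℕ → Fin (N * m)
  pA A l = combine A ⟦ + l ⟧

  qB : Fin N → Fin m → ℕ → Fin (N * m)
  qB B d l = combine B ⟦ + l ⊕ ↑ d ⟧

  pA-closes : ∀ A → pA A m ≡ pA A 0
  pA-closes A = cong (combine A) (⟦⟧-cong (+ 1 by lemma (+ m)))
    where
    lemma : ∀ m → m ⊖ + 0 ≡ + 1 ⊗ m
    lemma = ℤ.solve-∀

  ∑-residues : ∀ a (h : Fin m) → ∑[ l ∈ upTo m ] δ (⟦ + l ⊕ a ⟧ ≟ h) ≡ 1
  ∑-residues a h = trans
    (∑-upTo-single m _ (Fin.toℕ<n l₀)
      (λ l l<m l≢ → δ-no (⟦ + l ⊕ a ⟧ ≟ h) (λ eq →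
        l≢ (≋⇒≡ℕ l<m (Fin.toℕ<n l₀) (≋-trans (≋-by (⟦⟧≡⇒≋ eq) (shift (+ l) a (↑ h))) (≋-sym ↑⟦ ↑ h ⊖ a ⟧))))))
    (δ-yes (⟦ ↑ l₀ ⊕ a ⟧ ≟ h) (≋⇒⟦⟧≡ (≋-by ↑⟦ ↑ h ⊖ a ⟧ (shift′ (↑ l₀) a (↑ h)))))
    where
    l₀ = ⟦ ↑ h ⊖ a ⟧
    shift : ∀ l a h → l ⊖ (h ⊖ a) ≡ (l ⊕ a) ⊖ h
    shift = ℤ.solve-∀
    shift′ : ∀ l a h → (l ⊕ a) ⊖ h ≡ l ⊖ (h ⊖ a)
    shift′ = ℤ.solve-∀

  ∑-⟦+⟧ : ∀ h → ∑[ l ∈ upTo m ] δ (⟦ + l ⟧ ≟ h) ≡ 1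
  ∑-⟦+⟧ h = trans (∑-cong (upTo m) (λ l → cong (λ a → δ (⟦ a ⟧ ≟ h)) (lemma (+ l)))) (∑-residues (+ 0) h)
    where
    lemma : ∀ a → a ≡ a ⊕ + 0
    lemma = ℤ.solve-∀

  ∑-⟦+suc⟧ : ∀ h → ∑[ l ∈ upTo m ] δ (⟦ + suc l ⟧ ≟ h) ≡ 1
  ∑-⟦+suc⟧ h = trans (∑-cong (upTo m) (λ l → cong (λ a → δ (⟦ a ⟧ ≟ h)) (lemma (+ l)))) (∑-residues (+ 1) h)
    where
    lemma : ∀ a → + 1 ⊕ a ≡ a ⊕ + 1
    lemma = ℤ.solve-∀

  ∑-shifts : ∀ l h → ∑[ d ∈ allFin m ] δ (⟦ + l ⊕ ↑ d ⟧ ≟ h) ≡ 1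
  ∑-shifts l h = ∑-δ-unique (λ d → ⟦ + l ⊕ ↑ d ⟧ ≟ h) d₀
    (≋⇒⟦⟧≡ (≋-by ↑⟦ ↑ h ⊖ + l ⟧ (shift (+ l) (↑ d₀) (↑ h))))
    (λ d eq → ≋⇒≡ (≋-trans (≋-by (⟦⟧≡⇒≋ eq) (shift′ (+ l) (↑ d) (↑ h))) (≋-sym ↑⟦ ↑ h ⊖ + l ⟧)))
    where
    d₀ = ⟦ ↑ h ⊖ + l ⟧
    shift : ∀ l d h → (l ⊕ d) ⊖ h ≡ d ⊖ (h ⊖ l)
    shift = ℤ.solve-∀
    shift′ : ∀ l d h → d ⊖ (h ⊖ l) ≡ (l ⊕ d) ⊖ h
    shift′ = ℤ.solve-∀

  joinCycle : Fin m → ∀ {e : Fin N × Fin N} → proj₁ e ≢ proj₂ e → Cycle (m * 2) (N * m)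
  joinCycle d {A , B} A≢B = record
    { vertices = zigzag (pA A) (qB B d) m
    ; proper   = subst (All _) (sym (cycEdges-zigzag (pA A) (qB B d) m (pA-closes A)))
        (All-zigzagEdges (pA A) (qB B d) m
          (λ l eq → A≢B (Fin.combine-injectiveˡ A ⟦ + l ⟧ B ⟦ + l ⊕ ↑ d ⟧ eq))
          (λ l eq → A≢B (sym (Fin.combine-injectiveˡ B ⟦ + l ⊕ ↑ d ⟧ A ⟦ + suc l ⟧ eq))))
    }

  occurs-joinCycle : ∀ d {e} (e≢ : proj₁ e ≢ proj₂ e) (C : Fin N) (h : Fin m) →
    occurs (combine C h) (toList (vertices (joinCycle d {e} e≢))) ≡ δ (proj₁ e ≟ C) + δ (proj₂ e ≟ C)
  occurs-joinCycle d {A , B} _ C h = begin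
    occurs (combine C h) (toList (zigzag (pA A) (qB B d) m))
      ≡⟨ ∑-zigzag (pA A) (qB B d) m (λ x → δ (x ≟ combine C h)) ⟩
    ∑[ l ∈ upTo m ] (δ (pA A l ≟ combine C h) + δ (qB B d l ≟ combine C h))
      ≡⟨ ∑-cong (upTo m) (λ l → cong₂ _+_ (δ-combine A C ⟦ + l ⟧ h) (δ-combine B C ⟦ + l ⊕ ↑ d ⟧ h)) ⟩
    ∑[ l ∈ upTo m ] (δ (A ≟ C) * δ (⟦ + l ⟧ ≟ h) + δ (B ≟ C) * δ (⟦ + l ⊕ ↑ d ⟧ ≟ h))
      ≡⟨ ∑-+ (upTo m) (λ l → δ (A ≟ C) * δ (⟦ + l ⟧ ≟ h)) (λ l → δ (B ≟ C) * δ (⟦ + l ⊕ ↑ d ⟧ ≟ h)) ⟩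
    ∑[ l ∈ upTo m ] (δ (A ≟ C) * δ (⟦ + l ⟧ ≟ h)) + ∑[ l ∈ upTo m ] (δ (B ≟ C) * δ (⟦ + l ⊕ ↑ d ⟧ ≟ h))
      ≡⟨ cong₂ _+_ (trans (∑-*ˡ (upTo m) (δ (A ≟ C)) (λ l → δ (⟦ + l ⟧ ≟ h))) (cong (δ (A ≟ C) *_) (∑-⟦+⟧ h)))
                   (trans (∑-*ˡ (upTo m) (δ (B ≟ C)) (λ l → δ (⟦ + l ⊕ ↑ d ⟧ ≟ h))) (cong (δ (B ≟ C) *_) (∑-residues (↑ d) h))) ⟩
    δ (A ≟ C) * 1 + δ (B ≟ C) * 1
      ≡⟨ cong₂ _+_ (*-identityʳ (δ (A ≟ C))) (*-identityʳ (δ (B ≟ C))) ⟩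
    δ (A ≟ C) + δ (B ≟ C) ∎
    where open ≡-Reasoning

  joinEdges : Fin m → Fin N × Fin N → List (Fin (N * m) × Fin (N * m))
  joinEdges d (A , B) = zigzagEdges (pA A) (qB B d) m

  -- The even edges, from l to l + d, and the odd edges, from l + 1 to l + d, each run through
  -- K_{m,m} once over all `d`.
  ∑-hits-joinEdges : ∀ e (C D : Fin N) (h h′ : Fin m) →
    ∑[ d ∈ allFin m ] ∑ (joinEdges d e) (hits (combine C h) (combine D h′)) ≡ 2 * hits C D e
  ∑-hits-joinEdges (A , B) C D h h′ = begin
    ∑[ d ∈ allFin m ] ∑ (zigzagEdges (pA A) (qB B d) m) H
      ≡⟨ ∑-cong (allFin m) (λ d → trans (∑-zigzagEdges (pA A) (qB B d) m H)
           (trans (∑-cong (upTo m) (λ l → cong (_+_ (H (pA A l , qB B d l))) (hits-flip (combine C h) (combine D h′) (qB B d l) (pA A (suc l)))))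
                  (∑-+ (upTo m) (λ l → H (pA A l , qB B d l)) (λ l → H (pA A (suc l) , qB B d l))))) ⟩
    ∑[ d ∈ allFin m ] (∑[ l ∈ upTo m ] H (pA A l , qB B d l) + ∑[ l ∈ upTo m ] H (pA A (suc l) , qB B d l))
      ≡⟨ ∑-+ (allFin m) (λ d → ∑[ l ∈ upTo m ] H (pA A l , qB B d l)) (λ d → ∑[ l ∈ upTo m ] H (pA A (suc l) , qB B d l)) ⟩
    ∑[ d ∈ allFin m ] ∑[ l ∈ upTo m ] H (pA A l , qB B d l) + ∑[ d ∈ allFin m ] ∑[ l ∈ upTo m ] H (pA A (suc l) , qB B d l)
      ≡⟨ cong₂ _+_ (∑-hits-join A B C D h h′ (λ l → ⟦ + l ⟧) (λ l d → ⟦ + l ⊕ ↑ d ⟧) ∑-⟦+⟧ ∑-shifts)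
                   (∑-hits-join A B C D h h′ (λ l → ⟦ + suc l ⟧) (λ l d → ⟦ + l ⊕ ↑ d ⟧) ∑-⟦+suc⟧ ∑-shifts) ⟩
    hits C D (A , B) + hits C D (A , B)
      ≡⟨ cong (_+_ (hits C D (A , B))) (+-identityʳ _) ⟨
    2 * hits C D (A , B) ∎
    where
    open ≡-Reasoning
    H = hits (combine C h) (combine D h′)

  joinFactor : OneFactor N → Fin m → CycleFactor (m * 2) (N * m)
  joinFactor F d = record
    { members  = All.reduce (λ {e} → joinCycle d {e}) (proper F)
    ; spanning = combine-elim {N} {m} _ (λ C h → trans
        (∑-reduce (λ {e} → joinCycle d {e}) (proper F) (λ {e} e≢ → occurs-joinCycle d {e} e≢ C h)) (spanning F C))
    }

  ∑-hits-joinFactors : ∀ F (C D : Fin N) (h h′ : Fin m) →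
    ∑[ G ∈ map (joinFactor F) (allFin m) ] ∑[ c ∈ members G ] ∑ (edges c) (hits (combine C h) (combine D h′))
      ≡ 2 * ∑ (pairs F) (hits C D)
  ∑-hits-joinFactors F C D h h′ = begin
    ∑[ G ∈ map (joinFactor F) (allFin m) ] ∑[ c ∈ members G ] ∑ (edges c) H
      ≡⟨ ∑-map (joinFactor F) (allFin m) ⟩
    ∑[ d ∈ allFin m ] ∑[ c ∈ members (joinFactor F d) ] ∑ (edges c) H
      ≡⟨ ∑-cong (allFin m) (λ d → ∑-reduce (λ {e} → joinCycle d {e}) (proper F)
           (λ {e} _ → cong (λ es → ∑ es H) (cycEdges-zigzag (pA (proj₁ e)) (qB (proj₂ e) d) m (pA-closes (proj₁ e))))) ⟩
    ∑[ d ∈ allFin m ] ∑[ e ∈ pairs F ] ∑ (joinEdges d e) H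
      ≡⟨ ∑-swap (allFin m) (pairs F) (λ d e → ∑ (joinEdges d e) H) ⟩
    ∑[ e ∈ pairs F ] ∑[ d ∈ allFin m ] ∑ (joinEdges d e) H
      ≡⟨ ∑-cong (pairs F) (λ e → ∑-hits-joinEdges e C D h h′) ⟩
    ∑[ e ∈ pairs F ] (2 * hits C D e)
      ≡⟨ ∑-*ˡ (pairs F) 2 (hits C D) ⟩
    2 * ∑ (pairs F) (hits C D) ∎
    where
    open ≡-Reasoning
    H = hits (combine C h) (combine D h′)

-- Copies of a system on 2m points in the pairs of blocks of a 1-factor

module Copy {N m : ℕ} where

  copy : Fin N × Fin N → Fin (m + m) → Fin (N * m)
  copy (A , B) x = [ combine A , combine B ]′ (splitAt m x)

  -- Stated as a sum over the two halves instead of by cases on `x`, so that counting copied edges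
  -- becomes a polynomial identity.
  δ-copy : ∀ e x (C : Fin N) (h : Fin m) → δ (copy e x ≟ combine C h) ≡ δ (proj₁ e ≟ C) * δ (x ≟ h ↑ˡ m) + δ (proj₂ e ≟ C) * δ (x ≟ m ↑ʳ h)
  δ-copy (A , B) x C h with splitAt m x in eq
  ... | inj₁ i = begin
    δ (combine A i ≟ combine C h)                    ≡⟨ δ-combine A C i h ⟩
    δ (A ≟ C) * δ (i ≟ h)                            ≡⟨ +-identityʳ _ ⟨
    δ (A ≟ C) * δ (i ≟ h) + 0                        ≡⟨ cong₂ _+_
        (cong (δ (A ≟ C) *_) (δ-⇔ (i ≟ h) (x ≟ h ↑ˡ m) (λ { refl → sym (Fin.splitAt⁻¹-↑ˡ eq) })
          (λ { refl → inj₁-inj (trans (sym eq) (Fin.splitAt-↑ˡ m h m)) })))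
        (sym (trans (cong (δ (B ≟ C) *_) (δ-no (x ≟ m ↑ʳ h) λ { refl → inj₁≢inj₂ (trans (sym eq) (Fin.splitAt-↑ʳ m m h)) })) (*-zeroʳ (δ (B ≟ C))))) ⟩
    δ (A ≟ C) * δ (x ≟ h ↑ˡ m) + δ (B ≟ C) * δ (x ≟ m ↑ʳ h) ∎
    where
    open ≡-Reasoning
    inj₁-inj : ∀ {i h : Fin m} → inj₁ {B = Fin m} i ≡ inj₁ h → i ≡ h
    inj₁-inj refl = refl
    inj₁≢inj₂ : ∀ {i h : Fin m} → inj₁ i ≢ inj₂ h
    inj₁≢inj₂ ()
  ... | inj₂ i = begin
    δ (combine B i ≟ combine C h)                    ≡⟨ δ-combine B C i h ⟩
    δ (B ≟ C) * δ (i ≟ h)                            ≡⟨ cong₂ _+_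
        (sym (trans (cong (δ (A ≟ C) *_) (δ-no (x ≟ h ↑ˡ m) λ { refl → inj₂≢inj₁ (trans (sym eq) (Fin.splitAt-↑ˡ m h m)) })) (*-zeroʳ (δ (A ≟ C)))))
        (cong (δ (B ≟ C) *_) (δ-⇔ (i ≟ h) (x ≟ m ↑ʳ h) (λ { refl → sym (Fin.splitAt⁻¹-↑ʳ {m} eq) })
          (λ { refl → inj₂-inj (trans (sym eq) (Fin.splitAt-↑ʳ m m h)) }))) ⟩
    δ (A ≟ C) * δ (x ≟ h ↑ˡ m) + δ (B ≟ C) * δ (x ≟ m ↑ʳ h) ∎
    where
    open ≡-Reasoning
    inj₂-inj : ∀ {i h : Fin m} → inj₂ {A = Fin m} i ≡ inj₂ h → i ≡ h
    inj₂-inj refl = refl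
    inj₂≢inj₁ : ∀ {i h : Fin m} → inj₂ i ≢ inj₁ h
    inj₂≢inj₁ ()

  copy-injective : ∀ {e} → proj₁ e ≢ proj₂ e → ∀ {x y} → copy e x ≡ copy e y → x ≡ y
  copy-injective {A , B} A≢B {x} {y} eq with splitAt m x in eqx | splitAt m y in eqy
  ... | inj₁ i | inj₁ j = trans (sym (Fin.splitAt⁻¹-↑ˡ eqx))
        (trans (cong (_↑ˡ m) (Fin.combine-injectiveʳ A i A j eq)) (Fin.splitAt⁻¹-↑ˡ eqy))
  ... | inj₁ i | inj₂ j = ⊥-elim (A≢B (Fin.combine-injectiveˡ A i B j eq))
  ... | inj₂ i | inj₁ j = ⊥-elim (A≢B (sym (Fin.combine-injectiveˡ B i A j eq)))
  ... | inj₂ i | inj₂ j = trans (sym (Fin.splitAt⁻¹-↑ʳ {m} eqx))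
        (trans (cong (m ↑ʳ_) (Fin.combine-injectiveʳ B i B j eq)) (Fin.splitAt⁻¹-↑ʳ {m} eqy))

  ↑ˡ≢↑ʳ : ∀ (i j : Fin m) → i ↑ˡ m ≢ m ↑ʳ j
  ↑ˡ≢↑ʳ i j eq with trans (sym (Fin.splitAt-↑ˡ m i m)) (trans (cong (splitAt m) eq) (Fin.splitAt-↑ʳ m m j))
  ... | ()

  copyEdge : Fin N × Fin N → Fin (m + m) × Fin (m + m) → Fin (N * m) × Fin (N * m)
  copyEdge e = Product.map (copy e) (copy e)

  -- The four terms say which block of the pair `e` plays the role of `C` and which that of `D`.
  hits-copy : ∀ e (C D : Fin N) (h h′ : Fin m) f → hits (combine C h) (combine D h′) (copyEdge e f) ≡
    (δ (proj₁ e ≟ C) * δ (proj₁ e ≟ D)) * hits (h ↑ˡ m) (h′ ↑ˡ m) f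
    + (δ (proj₁ e ≟ C) * δ (proj₂ e ≟ D)) * hits (h ↑ˡ m) (m ↑ʳ h′) f
    + (δ (proj₂ e ≟ C) * δ (proj₁ e ≟ D)) * hits (m ↑ʳ h) (h′ ↑ˡ m) f
    + (δ (proj₂ e ≟ C) * δ (proj₂ e ≟ D)) * hits (m ↑ʳ h) (m ↑ʳ h′) f
  hits-copy e C D h h′ (x , y) = trans
    (cong₂ _+_ (cong₂ _*_ (δ-copy e x C h) (δ-copy e y D h′)) (cong₂ _*_ (δ-copy e x D h′) (δ-copy e y C h)))
    (lemma (δ (proj₁ e ≟ C)) (δ (proj₂ e ≟ C)) (δ (proj₁ e ≟ D)) (δ (proj₂ e ≟ D))
      (δ (x ≟ h ↑ˡ m)) (δ (x ≟ m ↑ʳ h)) (δ (x ≟ h′ ↑ˡ m)) (δ (x ≟ m ↑ʳ h′))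
      (δ (y ≟ h ↑ˡ m)) (δ (y ≟ m ↑ʳ h)) (δ (y ≟ h′ ↑ˡ m)) (δ (y ≟ m ↑ʳ h′)))
    where
    lemma : ∀ a b a′ b′ x₀ x₁ x₀′ x₁′ y₀ y₁ y₀′ y₁′ →
      (a * x₀ + b * x₁) * (a′ * y₀′ + b′ * y₁′) + (a′ * x₀′ + b′ * x₁′) * (a * y₀ + b * y₁) ≡
      (a * a′) * (x₀ * y₀′ + x₀′ * y₀) + (a * b′) * (x₀ * y₁′ + x₁′ * y₀)
      + (b * a′) * (x₁ * y₀′ + x₀′ * y₁) + (b * b′) * (x₁ * y₁′ + x₁′ * y₁)
    lemma = solve-∀

  cycEdges-copy : ∀ {k} e (xs : Vec (Fin (m + m)) k) →
    cycEdges (toList (Vec.map (copy e) xs)) ≡ map (copyEdge e) (cycEdges (toList xs))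
  cycEdges-copy e xs = trans (cong cycEdges (toList-map (copy e) xs)) (cycEdges-map (copy e) (toList xs))

  copyCycle : ∀ {k} → Cycle k (m + m) → ∀ {e : Fin N × Fin N} → proj₁ e ≢ proj₂ e → Cycle k (N * m)
  copyCycle c {e} e≢ = record
    { vertices = Vec.map (copy e) (vertices c)
    ; proper   = subst (All _) (sym (cycEdges-copy e (vertices c)))
                   (All.map⁺ (All.map (λ x≢y eq → x≢y (copy-injective {e} e≢ eq)) (proper c)))
    }

  occurs-copyCycle : ∀ {k} (c : Cycle k (m + m)) {e} (e≢ : proj₁ e ≢ proj₂ e) (C : Fin N) (h : Fin m) →
    occurs (combine C h) (toList (vertices (copyCycle c {e} e≢))) ≡
    δ (proj₁ e ≟ C) * occurs (h ↑ˡ m) (toList (vertices c)) + δ (proj₂ e ≟ C) * occurs (m ↑ʳ h) (toList (vertices c))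
  occurs-copyCycle c {e} _ C h = begin
    occurs (combine C h) (toList (Vec.map (copy e) (vertices c)))
      ≡⟨ cong (occurs (combine C h)) (toList-map (copy e) (vertices c)) ⟩
    occurs (combine C h) (map (copy e) xs)
      ≡⟨ ∑-map (copy e) xs ⟩
    ∑[ x ∈ xs ] δ (copy e x ≟ combine C h)
      ≡⟨ ∑-cong xs (λ x → δ-copy e x C h) ⟩
    ∑[ x ∈ xs ] (a * δ (x ≟ h ↑ˡ m) + b * δ (x ≟ m ↑ʳ h))
      ≡⟨ ∑-+ xs (λ x → a * δ (x ≟ h ↑ˡ m)) (λ x → b * δ (x ≟ m ↑ʳ h)) ⟩
    ∑[ x ∈ xs ] (a * δ (x ≟ h ↑ˡ m)) + ∑[ x ∈ xs ] (b * δ (x ≟ m ↑ʳ h))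
      ≡⟨ cong₂ _+_ (∑-*ˡ xs a _) (∑-*ˡ xs b _) ⟩
    a * occurs (h ↑ˡ m) xs + b * occurs (m ↑ʳ h) xs ∎
    where
    open ≡-Reasoning
    xs = toList (vertices c)
    a = δ (proj₁ e ≟ C)
    b = δ (proj₂ e ≟ C)

  module _ {k : ℕ} (F : OneFactor N) where

    copyFactor : CycleFactor k (m + m) → CycleFactor k (N * m)
    copyFactor G = record
      { members  = concatMap (λ c → All.reduce (λ {e} → copyCycle c {e}) (proper F)) (members G)
      ; spanning = combine-elim {N} {m} _ spans
      }
      where
      open ≡-Reasoning
      spans : ∀ (C : Fin N) (h : Fin m) → ∑[ c ∈ concatMap (λ c → All.reduce (λ {e} → copyCycle c {e}) (proper F)) (members G) ]
                        occurs (combine C h) (toList (vertices c)) ≡ 1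
      spans C h = begin
        ∑[ c ∈ concatMap (λ c → All.reduce (λ {e} → copyCycle c {e}) (proper F)) (members G) ]
            occurs (combine C h) (toList (vertices c))
          ≡⟨ ∑-concatMap (λ c → All.reduce (λ {e} → copyCycle c {e}) (proper F)) (members G) ⟩
        ∑[ c ∈ members G ] ∑[ c′ ∈ All.reduce (λ {e} → copyCycle c {e}) (proper F) ] occurs (combine C h) (toList (vertices c′))
          ≡⟨ ∑-cong (members G) (λ c → ∑-reduce (λ {e} → copyCycle c {e}) (proper F) (λ {e} e≢ → occurs-copyCycle c {e} e≢ C h)) ⟩
        ∑[ c ∈ members G ] ∑[ e ∈ pairs F ] (a e * oˡ c + b e * oʳ c)
          ≡⟨ ∑-swap (members G) (pairs F) (λ c e → a e * oˡ c + b e * oʳ c) ⟩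
        ∑[ e ∈ pairs F ] ∑[ c ∈ members G ] (a e * oˡ c + b e * oʳ c)
          ≡⟨ ∑-cong (pairs F) (λ e → trans (∑-+ (members G) (λ c → a e * oˡ c) (λ c → b e * oʳ c))
               (cong₂ _+_ (trans (∑-*ˡ (members G) (a e) oˡ) (trans (cong (a e *_) (spanning G (h ↑ˡ m))) (*-identityʳ (a e))))
                          (trans (∑-*ˡ (members G) (b e) oʳ) (trans (cong (b e *_) (spanning G (m ↑ʳ h))) (*-identityʳ (b e)))))) ⟩
        ∑[ e ∈ pairs F ] (a e + b e)
          ≡⟨ spanning F C ⟩
        1 ∎
        where
        a b : Fin N × Fin N → ℕ
        a e = δ (proj₁ e ≟ C)
        b e = δ (proj₂ e ≟ C)
        oˡ oʳ : Cycle k (m + m) → ℕ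
        oˡ c = occurs (h ↑ˡ m) (toList (vertices c))
        oʳ c = occurs (m ↑ʳ h) (toList (vertices c))

    module _ (S : CycleSystem k (m + m)) where

      allEdges : List (Fin (m + m) × Fin (m + m))
      allEdges = concatMap (λ G → concatMap edges (members G)) (factors S)

      ∑-allEdges : ∀ f → ∑ allEdges f ≡ ∑[ G ∈ factors S ] ∑[ c ∈ members G ] ∑ (edges c) f
      ∑-allEdges f = trans (∑-concatMap (λ G → concatMap edges (members G)) (factors S))
        (∑-cong (factors S) (λ G → ∑-concatMap edges (members G)))

      ∑-hits-allEdges : ∀ {x y} → x ≢ y → ∑ allEdges (hits x y) ≡ 2
      ∑-hits-allEdges x≢y = trans (∑-allEdges _) (twice S x≢y)

      ∑-copyFactors : ∀ H → ∑[ G ∈ map copyFactor (factors S) ] ∑[ c ∈ members G ] ∑ (edges c) H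
                          ≡ ∑[ e ∈ pairs F ] ∑[ f ∈ allEdges ] H (copyEdge e f)
      ∑-copyFactors H = begin
        ∑[ G ∈ map copyFactor (factors S) ] ∑[ c ∈ members G ] ∑ (edges c) H
          ≡⟨ ∑-map copyFactor (factors S) ⟩
        ∑[ G ∈ factors S ] ∑[ c ∈ members (copyFactor G) ] ∑ (edges c) H
          ≡⟨ ∑-cong (factors S) (λ G → trans (∑-concatMap (λ c → All.reduce (λ {e} → copyCycle c {e}) (proper F)) (members G))
               (∑-cong (members G) (λ c → ∑-reduce (λ {e} → copyCycle c {e}) (proper F)
                 (λ {e} _ → trans (cong (λ es → ∑ es H) (cycEdges-copy e (vertices c))) (∑-map (copyEdge e) (edges c)))))) ⟩
        ∑[ G ∈ factors S ] ∑[ c ∈ members G ] ∑[ e ∈ pairs F ] ∑[ f ∈ edges c ] H (copyEdge e f)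
          ≡⟨ ∑-cong (factors S) (λ G → ∑-cong (members G) (λ c → ∑-swap (pairs F) (edges c) (λ e f → H (copyEdge e f)))) ⟩
        ∑[ G ∈ factors S ] ∑[ c ∈ members G ] ∑[ f ∈ edges c ] ∑[ e ∈ pairs F ] H (copyEdge e f)
          ≡⟨ ∑-allEdges (λ f → ∑[ e ∈ pairs F ] H (copyEdge e f)) ⟨
        ∑[ f ∈ allEdges ] ∑[ e ∈ pairs F ] H (copyEdge e f)
          ≡⟨ ∑-swap allEdges (pairs F) (λ f e → H (copyEdge e f)) ⟩
        ∑[ e ∈ pairs F ] ∑[ f ∈ allEdges ] H (copyEdge e f) ∎
        where open ≡-Reasoning

      module _ (C D : Fin N) (h h′ : Fin m) where

        private
          t₀₀ = ∑ allEdges (hits (h ↑ˡ m) (h′ ↑ˡ m))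
          t₀₁ = ∑ allEdges (hits (h ↑ˡ m) (m ↑ʳ h′))
          t₁₀ = ∑ allEdges (hits (m ↑ʳ h) (h′ ↑ˡ m))
          t₁₁ = ∑ allEdges (hits (m ↑ʳ h) (m ↑ʳ h′))

          t₀₁≡2 : t₀₁ ≡ 2
          t₀₁≡2 = ∑-hits-allEdges (↑ˡ≢↑ʳ h h′)

          t₁₀≡2 : t₁₀ ≡ 2
          t₁₀≡2 = ∑-hits-allEdges (↑ˡ≢↑ʳ h′ h ∘ sym)

        -- The two mixed counts are 2 because the halves are disjoint. `t₀₀` and `t₁₁` stay
        -- unevaluated: for `h ≡ h′` they concern loops, about which `twice` says nothing.
        ∑-hits-copy : ∀ e → ∑[ f ∈ allEdges ] hits (combine C h) (combine D h′) (copyEdge e f) ≡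
            (δ (proj₁ e ≟ C) * δ (proj₁ e ≟ D)) * t₀₀ + (δ (proj₁ e ≟ C) * δ (proj₂ e ≟ D)) * 2
          + (δ (proj₂ e ≟ C) * δ (proj₁ e ≟ D)) * 2 + (δ (proj₂ e ≟ C) * δ (proj₂ e ≟ D)) * t₁₁
        ∑-hits-copy e = begin
          ∑[ f ∈ allEdges ] hits (combine C h) (combine D h′) (copyEdge e f)
            ≡⟨ ∑-cong allEdges (hits-copy e C D h h′) ⟩
          ∑[ f ∈ allEdges ] (f₀₀ f + f₀₁ f + f₁₀ f + f₁₁ f)
            ≡⟨ ∑-+ allEdges (λ f → f₀₀ f + f₀₁ f + f₁₀ f) f₁₁ ⟩
          ∑[ f ∈ allEdges ] (f₀₀ f + f₀₁ f + f₁₀ f) + ∑ allEdges f₁₁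
            ≡⟨ cong (_+ ∑ allEdges f₁₁) (∑-+ allEdges (λ f → f₀₀ f + f₀₁ f) f₁₀) ⟩
          ∑[ f ∈ allEdges ] (f₀₀ f + f₀₁ f) + ∑ allEdges f₁₀ + ∑ allEdges f₁₁
            ≡⟨ cong (λ z → z + ∑ allEdges f₁₀ + ∑ allEdges f₁₁) (∑-+ allEdges f₀₀ f₀₁) ⟩
          ∑ allEdges f₀₀ + ∑ allEdges f₀₁ + ∑ allEdges f₁₀ + ∑ allEdges f₁₁
            ≡⟨ cong₂ _+_ (cong₂ _+_ (cong₂ _+_
                 (∑-*ˡ allEdges c₀₀ (hits (h ↑ˡ m) (h′ ↑ˡ m)))
                 (trans (∑-*ˡ allEdges c₀₁ (hits (h ↑ˡ m) (m ↑ʳ h′))) (cong (c₀₁ *_) t₀₁≡2)))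
                 (trans (∑-*ˡ allEdges c₁₀ (hits (m ↑ʳ h) (h′ ↑ˡ m))) (cong (c₁₀ *_) t₁₀≡2)))
                 (∑-*ˡ allEdges c₁₁ (hits (m ↑ʳ h) (m ↑ʳ h′))) ⟩
          c₀₀ * t₀₀ + c₀₁ * 2 + c₁₀ * 2 + c₁₁ * t₁₁ ∎
          where
          open ≡-Reasoning
          c₀₀ = δ (proj₁ e ≟ C) * δ (proj₁ e ≟ D)
          c₀₁ = δ (proj₁ e ≟ C) * δ (proj₂ e ≟ D)
          c₁₀ = δ (proj₂ e ≟ C) * δ (proj₁ e ≟ D)
          c₁₁ = δ (proj₂ e ≟ C) * δ (proj₂ e ≟ D)
          f₀₀ f₀₁ f₁₀ f₁₁ : Fin (m + m) × Fin (m + m) → ℕ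
          f₀₀ f = c₀₀ * hits (h ↑ˡ m) (h′ ↑ˡ m) f
          f₀₁ f = c₀₁ * hits (h ↑ˡ m) (m ↑ʳ h′) f
          f₁₀ f = c₁₀ * hits (m ↑ʳ h) (h′ ↑ˡ m) f
          f₁₁ f = c₁₁ * hits (m ↑ʳ h) (m ↑ʳ h′) f

      -- A block cannot be both `C` and `D`, which kills the terms with `t₀₀` and `t₁₁`; the mixed
      -- ones leave 2 for each pair joining `C` to `D`.
      ∑-copyFactors-distinct : ∀ {C D : Fin N} (h h′ : Fin m) → C ≢ D →
        ∑[ G ∈ map copyFactor (factors S) ] ∑[ c ∈ members G ] ∑ (edges c) (hits (combine C h) (combine D h′))
          ≡ 2 * ∑ (pairs F) (hits C D)
      ∑-copyFactors-distinct {C} {D} h h′ C≢D = begin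
        ∑[ G ∈ map copyFactor (factors S) ] ∑[ c ∈ members G ] ∑ (edges c) (hits (combine C h) (combine D h′))
          ≡⟨ ∑-copyFactors (hits (combine C h) (combine D h′)) ⟩
        ∑[ e ∈ pairs F ] ∑[ f ∈ allEdges ] hits (combine C h) (combine D h′) (copyEdge e f)
          ≡⟨ ∑-cong (pairs F) (λ e → trans (∑-hits-copy C D h h′ e) (simplify e)) ⟩
        ∑[ e ∈ pairs F ] (2 * hits C D e)
          ≡⟨ ∑-*ˡ (pairs F) 2 (hits C D) ⟩
        2 * ∑ (pairs F) (hits C D) ∎
        where
        open ≡-Reasoning
        lemma : ∀ a b a′ b′ t t′ → 0 * t + (a * b′) * 2 + (b * a′) * 2 + 0 * t′ ≡ 2 * (a * b′ + a′ * b)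
        lemma = solve-∀
        simplify : ∀ e → let a = δ (proj₁ e ≟ C); b = δ (proj₂ e ≟ C); a′ = δ (proj₁ e ≟ D); b′ = δ (proj₂ e ≟ D) in
          ∀ {t t′} → (a * a′) * t + (a * b′) * 2 + (b * a′) * 2 + (b * b′) * t′ ≡ 2 * hits C D e
        simplify (A , B) {t} {t′} rewrite δδ-distinct A C≢D | δδ-distinct B C≢D =
          lemma (δ (A ≟ C)) (δ (B ≟ C)) (δ (A ≟ D)) (δ (B ≟ D)) t t′

      -- The mixed terms vanish because the two blocks of a pair differ. Just one pair of `F`
      -- contains `C`, and its copy of the system uses the edge twice.
      ∑-copyFactors-same : ∀ (C : Fin N) {h h′ : Fin m} → h ≢ h′ →
        ∑[ G ∈ map copyFactor (factors S) ] ∑[ c ∈ members G ] ∑ (edges c) (hits (combine C h) (combine C h′)) ≡ 2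
      ∑-copyFactors-same C {h} {h′} h≢h′ = begin
        ∑[ G ∈ map copyFactor (factors S) ] ∑[ c ∈ members G ] ∑ (edges c) (hits (combine C h) (combine C h′))
          ≡⟨ ∑-copyFactors (hits (combine C h) (combine C h′)) ⟩
        ∑[ e ∈ pairs F ] ∑[ f ∈ allEdges ] hits (combine C h) (combine C h′) (copyEdge e f)
          ≡⟨ ∑-cong-All (All.map (λ {e} e≢ → trans (∑-hits-copy C C h h′ e) (simplify e e≢)) (proper F)) ⟩
        ∑[ e ∈ pairs F ] (2 * (δ (proj₁ e ≟ C) + δ (proj₂ e ≟ C)))
          ≡⟨ ∑-*ˡ (pairs F) 2 _ ⟩
        2 * ∑[ e ∈ pairs F ] (δ (proj₁ e ≟ C) + δ (proj₂ e ≟ C))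
          ≡⟨ cong (2 *_) (spanning F C) ⟩
        2 ∎
        where
        open ≡-Reasoning
        lemma : ∀ a b → a * 2 + 0 * 2 + 0 * 2 + b * 2 ≡ 2 * (a + b)
        lemma = solve-∀
        simplify : ∀ e → proj₁ e ≢ proj₂ e → let a = δ (proj₁ e ≟ C); b = δ (proj₂ e ≟ C) in
          (a * a) * ∑ allEdges (hits (h ↑ˡ m) (h′ ↑ˡ m)) + (a * b) * 2 + (b * a) * 2
            + (b * b) * ∑ allEdges (hits (m ↑ʳ h) (m ↑ʳ h′)) ≡ 2 * (a + b)
        simplify (A , B) A≢B
          rewrite ∑-hits-allEdges {h ↑ˡ m} {h′ ↑ˡ m} (h≢h′ ∘ Fin.↑ˡ-injective m h h′)
                | ∑-hits-allEdges {m ↑ʳ h} {m ↑ʳ h′} (h≢h′ ∘ Fin.↑ʳ-injective m h h′)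
                | δδ-disjoint C A≢B | δδ-disjoint C (A≢B ∘ sym) | δδ-same A C | δδ-same B C
          = lemma (δ (A ≟ C)) (δ (B ≟ C))

-- Inside a block only the copies count, as no 1-factor joins a block to itself. Between two blocks
-- every 1-factor, the first included, contributes twice its number of pairs joining them, and over
-- the whole 1-factorization there is one such pair.
blowUp : ∀ {N} s → OneFactorization N → CycleSystem (suc s * 2) (suc s + suc s) →
  CycleSystem (suc s * 2) (N * suc s)
blowUp {N} s O S = record
  { factors = inside ++ across
  ; twice   = λ {v} {w} → combine-elim {N} {suc s} (λ v → ∀ w → v ≢ w → total v w ≡ 2)
      (λ C h → combine-elim {N} {suc s} (λ w → combine C h ≢ w → total (combine C h) w ≡ 2) (λ D h′ → count C D h h′)) v w
  }
  where
  open Copy {N} {suc s}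
  open Join {N} s
  open ≡-Reasoning
  inside across : List (CycleFactor (suc s * 2) (N * suc s))
  inside = map (copyFactor (first O)) (factors S)
  across = concatMap (λ F → map (joinFactor F) (allFin (suc s))) (rest O)
  total : Fin (N * suc s) → Fin (N * suc s) → ℕ
  total v w = ∑[ F ∈ inside ++ across ] ∑[ c ∈ members F ] ∑ (edges c) (hits v w)
  total-across : ∀ (C D : Fin N) (h h′ : Fin (suc s)) →
    ∑[ F ∈ across ] ∑[ c ∈ members F ] ∑ (edges c) (hits (combine C h) (combine D h′))
      ≡ ∑[ F ∈ rest O ] (2 * ∑ (pairs F) (hits C D))
  total-across C D h h′ = trans (∑-concatMap (λ F → map (joinFactor F) (allFin (suc s))) (rest O))
    (∑-cong (rest O) (λ F → ∑-hits-joinFactors F C D h h′))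
  count : ∀ (C D : Fin N) (h h′ : Fin (suc s)) → combine C h ≢ combine D h′ → total (combine C h) (combine D h′) ≡ 2
  count C D h h′ v≢w with C ≟ D
  ... | yes refl = begin
    total (combine C h) (combine C h′)
      ≡⟨ ∑-++ inside across ⟩
    _ ≡⟨ cong₂ _+_ (∑-copyFactors-same (first O) S C (λ { refl → v≢w refl }))
           (trans (total-across C C h h′) (∑-zero (rest O) (λ F → cong (2 *_)
             (trans (∑-cong-All (All.map (hits-loop C) (proper F))) (∑-zero (pairs F) (λ _ → refl)))))) ⟩
    2 ∎
  ... | no C≢D = begin
    total (combine C h) (combine D h′)
      ≡⟨ ∑-++ inside across ⟩
    _ ≡⟨ cong₂ _+_ (∑-copyFactors-distinct (first O) S h h′ C≢D) (total-across C D h h′) ⟩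
    ∑[ F ∈ first O ∷ rest O ] (2 * ∑ (pairs F) (hits C D))
      ≡⟨ ∑-*ˡ (first O ∷ rest O) 2 (λ F → ∑ (pairs F) (hits C D)) ⟩
    2 * ∑[ F ∈ first O ∷ rest O ] ∑ (pairs F) (hits C D)
      ≡⟨ cong (2 *_) (once O C≢D) ⟩
    2 ∎

-- Arc decompositions from idempotent Latin squares

-- arcs i is the permutation of Fin u ∖ {i} given by row i of an idempotent Latin square.
record ArcDecomposition (u : ℕ) : Set where
  field
    arcs     : Fin u → List (Fin u × Fin u)
    loopless : ∀ i → All (λ e → proj₁ e ≢ proj₂ e) (arcs i)
    sources  : ∀ i v → ∑[ e ∈ arcs i ] δ (proj₁ e ≟ v) + δ (i ≟ v) ≡ 1
    targets  : ∀ i v → ∑[ e ∈ arcs i ] δ (proj₂ e ≟ v) + δ (i ≟ v) ≡ 1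
    once     : ∀ {v w} → v ≢ w → ∑[ i ∈ allFin u ] ∑[ e ∈ arcs i ] (δ (proj₁ e ≟ v) * δ (proj₂ e ≟ w)) ≡ 1

∑-filter : {A : Set} {P : A → Set} (P? : ∀ x → Dec (P x)) (xs : List A) {f : A → ℕ} →
  ∑ (filter P? xs) f ≡ ∑[ x ∈ xs ] (δ (P? x) * f x)
∑-filter P? []           = refl
∑-filter P? (x ∷ xs) {f} with P? x
... | yes _ = cong₂ _+_ (sym (+-identityʳ (f x))) (∑-filter P? xs)
... | no _  = ∑-filter P? xs

∑-filter-split : {A : Set} {P : A → Set} (P? : ∀ x → Dec (P x)) (xs : List A) (f : A → ℕ) →
  ∑ (filter (¬? ∘ P?) xs) f + ∑ (filter P? xs) f ≡ ∑ xs f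
∑-filter-split P? []       f = refl
∑-filter-split P? (x ∷ xs) f with P? x
... | yes _ = trans (x∙yz≈y∙xz +-commutativeSemigroup (∑ (filter (¬? ∘ P?) xs) f) (f x) _)
                (cong (f x +_) (∑-filter-split P? xs f))
... | no _  = trans (+-assoc (f x) _ _) (cong (f x +_) (∑-filter-split P? xs f))

-- A surjection of a finite set to itself is a bijection, so for rows and columns of a Latin square
-- it is enough to exhibit solutions.
∑-onto : ∀ {n} (f : Fin n → Fin n) → (∀ y → ∃ λ x → f x ≡ y) → ∀ y → ∑[ x ∈ allFin n ] δ (f x ≟ y) ≡ 1
∑-onto {n} f onto y = trans (sym (∑-map f (allFin n)))
  (occurs-pigeonhole (map f (allFin n)) (trans (length-map f (allFin n)) (length-tabulate id))
    (λ z → subst (_∈ map f (allFin n)) (proj₂ (onto z)) (∈-map⁺ f (∈-allFin (proj₁ (onto z))))) y)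

module FromLatinSquare {u : ℕ} (σ : Fin u → Fin u → Fin u)
  (idempotent : ∀ i → σ i i ≡ i) (fixes : ∀ i a → σ i a ≡ a → a ≡ i)
  (solveʳ : ∀ i b → ∃ λ a → σ i a ≡ b) (solveˡ : ∀ a b → ∃ λ i → σ i a ≡ b) where

  others : Fin u → List (Fin u)
  others i = filter (λ a → ¬? (a ≟ i)) (allFin u)

  ∑-others : ∀ i f → ∑ (others i) f + f i ≡ ∑ (allFin u) f
  ∑-others i f = trans (cong (∑ (others i) f +_) (sym alone)) (∑-filter-split (_≟ i) (allFin u) f)
    where
    alone : ∑ (filter (_≟ i) (allFin u)) f ≡ f i
    alone = trans (∑-filter (_≟ i) (allFin u)) (trans
      (∑-single (λ x → δ (x ≟ i) * f x) i (λ x x≢i → cong (_* f x) (δ-no (x ≟ i) x≢i)))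
      (trans (cong (_* f i) (δ-yes (i ≟ i) refl)) (+-identityʳ (f i))))

  row : Fin u → List (Fin u × Fin u)
  row i = map (λ a → a , σ i a) (others i)

  -- By idempotence the omitted column of row `i` is the pair `(i , i)`; with it restored the sum
  -- runs over a full row.
  ∑-row : ∀ i f → ∑ (row i) f + f (i , i) ≡ ∑[ a ∈ allFin u ] f (a , σ i a)
  ∑-row i f = trans (cong₂ _+_ (∑-map (λ a → a , σ i a) (others i)) (cong (λ b → f (i , b)) (sym (idempotent i))))
                    (∑-others i (λ a → f (a , σ i a)))

  arcDecomposition : ArcDecomposition u
  arcDecomposition = record
    { arcs     = row
    ; loopless = λ i → All.map⁺ (All.map (λ a≢i eq → a≢i (fixes i _ (sym eq))) (All.all-filter (λ a → ¬? (a ≟ i)) (allFin u)))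
    ; sources  = λ i v → trans (∑-row i (λ e → δ (proj₁ e ≟ v))) (∑-δ-≟ v)
    ; targets  = λ i v → trans (∑-row i (λ e → δ (proj₂ e ≟ v))) (∑-onto (σ i) (solveʳ i) v)
    ; once     = λ {v} {w} v≢w → trans (∑-cong (allFin u) (entry v≢w)) (∑-onto (λ i → σ i v) (solveˡ v) w)
    }
    where
    open ≡-Reasoning
    entry : ∀ {v w} → v ≢ w → ∀ i → ∑[ e ∈ row i ] (δ (proj₁ e ≟ v) * δ (proj₂ e ≟ w)) ≡ δ (σ i v ≟ w)
    entry {v} {w} v≢w i = begin
      ∑ (row i) f                                           ≡⟨ +-identityʳ _ ⟨
      -- The pair `(i , i)` may be added at no cost: it is not `(v , w)` when `v ≢ w`.
      ∑ (row i) f + 0                                     ≡⟨ cong (∑ (row i) f +_) (δδ-distinct i v≢w) ⟨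
      ∑ (row i) f + f (i , i)                             ≡⟨ ∑-row i f ⟩
      ∑[ a ∈ allFin u ] (δ (a ≟ v) * δ (σ i a ≟ w))       ≡⟨ ∑-single (λ a → δ (a ≟ v) * δ (σ i a ≟ w)) v
                                                                 (λ a a≢v → cong (_* _) (δ-no (a ≟ v) a≢v)) ⟩
      δ (v ≟ v) * δ (σ i v ≟ w)                           ≡⟨ cong (_* δ (σ i v ≟ w)) (δ-yes (v ≟ v) refl) ⟩
      1 * δ (σ i v ≟ w)                                   ≡⟨ +-identityʳ _ ⟩
      δ (σ i v ≟ w)                                         ∎
      where
      f : Fin u × Fin u → ℕ
      f e = δ (proj₁ e ≟ v) * δ (proj₂ e ≟ w)

-- The idempotent Latin square (i , a) ↦ 2i − a of odd order, prolonged by ∞ = zero along the transversal a = i + 1.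

module Prolongation (s : ℕ) (1≤s : 1 ≤ s) where

  open OddResidues s

  size : ℕ
  size = suc n

  -- The cell (i , i + 1) of the odd square holds 2i - (i + 1) = i - 1. Prolongation puts ∞ there
  -- and moves the entry to (i , ∞) and to (∞ , i + 1); in terms of the column a = i + 1 the latter
  -- entry is a - 2.
  σ : Fin size → Fin size → Fin size
  σ zero    zero    = zero
  σ zero    (suc a) = suc ⟦ ↑ a ⊖ + 2 ⟧
  σ (suc i) zero    = suc ⟦ ↑ i ⊖ + 1 ⟧
  σ (suc i) (suc a) with a ≟ ⟦ ↑ i ⊕ + 1 ⟧
  ... | yes _ = zero
  ... | no _  = suc ⟦ ↑ i ⊕ ↑ i ⊖ ↑ a ⟧

  σ-∞ : ∀ {i a} → a ≡ ⟦ ↑ i ⊕ + 1 ⟧ → σ (suc i) (suc a) ≡ zero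
  σ-∞ {i} {a} eq with a ≟ ⟦ ↑ i ⊕ + 1 ⟧
  ... | yes _ = refl
  ... | no ne = ⊥-elim (ne eq)

  σ-finite : ∀ {i a b} → a ≢ ⟦ ↑ i ⊕ + 1 ⟧ → ↑ i ⊕ ↑ i ≋ ↑ a ⊕ ↑ b → σ (suc i) (suc a) ≡ suc b
  σ-finite {i} {a} {b} ne eq with a ≟ ⟦ ↑ i ⊕ + 1 ⟧
  ... | yes e = ⊥-elim (ne e)
  ... | no _  = cong suc (≋⇒⟦⟧≡ (≋-by eq (lemma (↑ i) (↑ a) (↑ b))))
    where
    lemma : ∀ i a b → (i ⊕ i ⊖ a) ⊖ b ≡ (i ⊕ i) ⊖ (a ⊕ b)
    lemma = ℤ.solve-∀

  private
    -- This is where `1 ≤ s` enters: 1 ≠ 0 keeps the transversal off the diagonal, and 2 ≠ 0 keeps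
    -- row ∞ from fixing a finite column. For `s = 0` the order would be 2, which has no idempotent
    -- Latin square.
    2<n : 2 < n
    2<n = s≤s (+-mono-≤ 1≤s 1≤s)

    1≉0 : ¬ (+ 1 ≋ + 0)
    1≉0 p with ≋⇒≡ℕ (<-trans (s<s z<s) 2<n) (<-trans z<s 2<n) p
    ... | ()

    2≉0 : ¬ (+ 2 ≋ + 0)
    2≉0 p with ≋⇒≡ℕ 2<n (<-trans z<s 2<n) p
    ... | ()

  idempotent : ∀ i → σ i i ≡ i
  idempotent zero    = refl
  idempotent (suc i) = σ-finite
    (λ eq → 1≉0 (≋-by (⟦⟧≡⇒≋ (sym eq)) (lemma (↑ i)))) ≋-refl
    where
    lemma : ∀ i → + 1 ⊖ + 0 ≡ (i ⊕ + 1) ⊖ i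
    lemma = ℤ.solve-∀

  fixes : ∀ i a → σ i a ≡ a → a ≡ i
  fixes zero    zero    eq = refl
  fixes zero    (suc a) eq = ⊥-elim (2≉0 (≋-by (≋-sym (⟦⟧≡⇒≋ (Fin.suc-injective eq))) (lemma (↑ a))))
    where
    lemma : ∀ a → + 2 ⊖ + 0 ≡ a ⊖ (a ⊖ + 2)
    lemma = ℤ.solve-∀
  fixes (suc i) (suc a) eq with a ≟ ⟦ ↑ i ⊕ + 1 ⟧
  fixes (suc i) (suc a) () | yes _
  fixes (suc i) (suc a) eq | no _ =
    cong suc (≋⇒≡ (≋-sym (double-cancel (≋-by (⟦⟧≡⇒≋ (Fin.suc-injective eq)) (lemma (↑ i) (↑ a))))))
    where
    lemma : ∀ i a → (i ⊕ i) ⊖ (a ⊕ a) ≡ (i ⊕ i ⊖ a) ⊖ a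
    lemma = ℤ.solve-∀

  -- In a finite row i the entry i - 1 has moved to column ∞. Any other b is still at a = 2i - b, as
  -- a = i + 1 would give b = i - 1.
  solveʳ : ∀ i b → ∃ λ a → σ i a ≡ b
  solveʳ zero    zero    = zero , refl
  solveʳ zero    (suc b) = suc ⟦ ↑ b ⊕ + 2 ⟧ ,
      cong suc (≋⇒⟦⟧≡ (≋-by ↑⟦ ↑ b ⊕ + 2 ⟧ (lemma (↑ ⟦ ↑ b ⊕ + 2 ⟧) (↑ b))))
    where
    lemma : ∀ a b → (a ⊖ + 2) ⊖ b ≡ a ⊖ (b ⊕ + 2)
    lemma = ℤ.solve-∀
  solveʳ (suc i) zero    = suc ⟦ ↑ i ⊕ + 1 ⟧ , σ-∞ refl
  solveʳ (suc i) (suc b) with b ≟ ⟦ ↑ i ⊖ + 1 ⟧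
  ... | yes eq = zero , cong suc (sym eq)
  ... | no ne  = suc a , σ-finite
      (λ eq → ne (sym (≋⇒⟦⟧≡ (≋-sum (≋-sym ↑⟦ ↑ i ⊕ ↑ i ⊖ ↑ b ⟧) (≋-sym (⟦⟧≡⇒≋ (sym eq))) (lemma (↑ i) (↑ b) (↑ a))))))
      (≋-by (≋-sym ↑⟦ ↑ i ⊕ ↑ i ⊖ ↑ b ⟧) (lemma′ (↑ i) (↑ b) (↑ a)))
    where
    a = ⟦ ↑ i ⊕ ↑ i ⊖ ↑ b ⟧
    lemma : ∀ i b a → (i ⊖ + 1) ⊖ b ≡ ((i ⊕ i ⊖ b) ⊖ a) ⊕ (a ⊖ (i ⊕ + 1))
    lemma = ℤ.solve-∀
    lemma′ : ∀ i b a → (i ⊕ i) ⊖ (a ⊕ b) ≡ (i ⊕ i ⊖ b) ⊖ a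
    lemma′ = ℤ.solve-∀

  -- In a finite column a the row of b is the midpoint of a and b, unless b = a - 2: then the
  -- midpoint a - 1 lies on the transversal and b has moved to row ∞.
  solveˡ : ∀ a b → ∃ λ i → σ i a ≡ b
  solveˡ a b with a ≟ b
  solveˡ a       b       | yes refl = a , idempotent a
  solveˡ zero    zero    | no ne    = ⊥-elim (ne refl)
  solveˡ zero    (suc b) | no ne    = suc ⟦ ↑ b ⊕ + 1 ⟧ ,
      cong suc (≋⇒⟦⟧≡ (≋-by ↑⟦ ↑ b ⊕ + 1 ⟧ (lemma (↑ ⟦ ↑ b ⊕ + 1 ⟧) (↑ b))))
    where
    lemma : ∀ i b → (i ⊖ + 1) ⊖ b ≡ i ⊖ (b ⊕ + 1)
    lemma = ℤ.solve-∀
  solveˡ (suc a) zero    | no ne    = suc ⟦ ↑ a ⊖ + 1 ⟧ ,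
      σ-∞ (sym (≋⇒⟦⟧≡ (≋-by ↑⟦ ↑ a ⊖ + 1 ⟧ (lemma (↑ ⟦ ↑ a ⊖ + 1 ⟧) (↑ a)))))
    where
    lemma : ∀ i a → (i ⊕ + 1) ⊖ a ≡ i ⊖ (a ⊖ + 1)
    lemma = ℤ.solve-∀
  solveˡ (suc a) (suc b) | no ne with b ≟ ⟦ ↑ a ⊖ + 2 ⟧
  ... | yes eq = zero , cong suc (sym eq)
  ... | no ne′ = suc i , σ-finite
      (λ eq → ne′ (sym (≋⇒⟦⟧≡ (≋-trans (≋-sum (a≋ eq) (a≋ eq) (lemma (↑ a) (↑ i))) (≋-by 2i (lemma′ (↑ i) (↑ a) (↑ b))))))) 2i
    where
    i = ⟦ half (↑ a ⊕ ↑ b) ⟧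
    2i : ↑ i ⊕ ↑ i ≋ ↑ a ⊕ ↑ b
    2i = double-⟦half⟧ (↑ a ⊕ ↑ b)
    a≋ : a ≡ ⟦ ↑ i ⊕ + 1 ⟧ → ↑ a ≋ ↑ i ⊕ + 1
    a≋ eq = ≋-sym (⟦⟧≡⇒≋ (sym eq))
    lemma : ∀ a i → (a ⊖ + 2) ⊖ (i ⊕ i ⊖ a) ≡ (a ⊖ (i ⊕ + 1)) ⊕ (a ⊖ (i ⊕ + 1))
    lemma = ℤ.solve-∀
    lemma′ : ∀ i a b → (i ⊕ i ⊖ a) ⊖ b ≡ (i ⊕ i) ⊖ (a ⊕ b)
    lemma′ = ℤ.solve-∀

  open FromLatinSquare σ idempotent fixes solveʳ solveˡ public using (arcDecomposition)

open ArcDecomposition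

-- Lifting cycles to two alternating rows

occurs≡0⇒All≢ : ∀ {n} (v : Fin n) xs → occurs v xs ≡ 0 → All (v ≢_) xs
occurs≡0⇒All≢ v []       _  = []
occurs≡0⇒All≢ v (x ∷ xs) eq with x ≟ v
... | no x≢v = (x≢v ∘ sym) ∷ occurs≡0⇒All≢ v xs eq

occurs≤1⇒Unique : ∀ {n} (xs : List (Fin n)) → (∀ v → occurs v xs ≤ 1) → Unique xs
occurs≤1⇒Unique []       _  = []
occurs≤1⇒Unique (x ∷ xs) ≤1 =
  occurs≡0⇒All≢ x xs (n≤0⇒n≡0 (+-cancelˡ-≤ 1 _ _ (subst (λ d → d + occurs x xs ≤ 1) (δ-yes (x ≟ x) refl) (≤1 x))))
  ∷ occurs≤1⇒Unique xs (λ v → ≤-trans (m≤n+m _ _) (≤1 v))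

module _ {A B : Set} where

  alternateList : A → A → List B → List (A × B)
  alternateList a b []       = []
  alternateList a b (x ∷ xs) = (a , x) ∷ alternateList b a xs

  alternate : ∀ {k} → A → A → Vec B k → Vec (A × B) k
  alternate a b []       = []
  alternate a b (x ∷ xs) = (a , x) ∷ alternate b a xs

  alternateEdges : A → A → List (B × B) → List ((A × B) × (A × B))
  alternateEdges a b []             = []
  alternateEdges a b ((x , y) ∷ es) = ((a , x) , (b , y)) ∷ alternateEdges b a es

  map-proj₂-alternate : ∀ {k} a b (xs : Vec B k) → map proj₂ (toList (alternate a b xs)) ≡ toList xs
  map-proj₂-alternate a b []       = refl
  map-proj₂-alternate a b (x ∷ xs) = cong (x ∷_) (map-proj₂-alternate b a xs)

  toList-alternate : ∀ {k} a b (xs : Vec B k) → toList (alternate a b xs) ≡ alternateList a b (toList xs)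
  toList-alternate a b []       = refl
  toList-alternate a b (x ∷ xs) = cong ((a , x) ∷_) (toList-alternate b a xs)

  alternate-snoc : ∀ m a b (xs : Vec B (m * 2)) x →
    toList (alternate a b xs) ++ [ (a , x) ] ≡ alternateList a b (toList xs ++ [ x ])
  alternate-snoc zero    a b []           x = refl
  alternate-snoc (suc m) a b (y ∷ z ∷ xs) x = cong (λ es → (a , y) ∷ (b , z) ∷ es) (alternate-snoc m a b xs x)

  zip-alternate : ∀ a b (xs ys : List B) →
    zip (alternateList a b xs) (alternateList b a ys) ≡ alternateEdges a b (zip xs ys)
  zip-alternate a b []       ys       = refl
  zip-alternate a b (x ∷ xs) []       = refl
  zip-alternate a b (x ∷ xs) (y ∷ ys) = cong (((a , x) , (b , y)) ∷_) (zip-alternate b a xs ys)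

  -- The labels match up around the cycle because its length is even.
  cycEdges-alternate : ∀ m a b (xs : Vec B (m * 2)) →
    cycEdges (toList (alternate a b xs)) ≡ alternateEdges a b (cycEdges (toList xs))
  cycEdges-alternate zero    a b []           = refl
  cycEdges-alternate (suc m) a b (x ∷ y ∷ xs) = trans
    (cong₂ zip (toList-alternate a b (x ∷ y ∷ xs)) (cong ((b , y) ∷_) (alternate-snoc m a b xs x)))
    (zip-alternate a b (x ∷ y ∷ toList xs) (y ∷ toList xs ++ [ x ]))

  All-alternateEdges : ∀ {P : B × B → Set} {Q : (A × B) × (A × B) → Set} a b →
    (∀ {x y} → P (x , y) → Q ((a , x) , (b , y))) → (∀ {x y} → P (x , y) → Q ((b , x) , (a , y))) →
    ∀ {es} → All P es → All Q (alternateEdges a b es)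
  All-alternateEdges a b f g []       = []
  All-alternateEdges a b f g (p ∷ ps) = f p ∷ All-alternateEdges b a g f ps

module Lift {m u g : ℕ} (S : CycleSystem (m * 2) g) (L : ArcDecomposition u) where

  lift : Fin u × Fin u → Cycle (m * 2) g → Vec (Vertex u g) (m * 2)
  lift e c = alternate (proj₁ e) (proj₂ e) (vertices c)

  uniques : ∀ cs → (∀ v → ∑[ c ∈ cs ] occurs v (toList (vertices {m * 2} {g} c)) ≤ 1) →
    All (Unique ∘ toList ∘ vertices) cs
  uniques []       _  = []
  uniques (c ∷ cs) ≤1 = occurs≤1⇒Unique (toList (vertices c)) (λ v → ≤-trans (m≤m+n _ _) (≤1 v))
                      ∷ uniques cs (λ v → ≤-trans (m≤n+m _ _) (≤1 v))

  -- Distinctness is already visible in the second coordinates; adjacency holds because the two rows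
  -- differ and so do consecutive points of the cycle.
  isCycle : ∀ {e} → proj₁ e ≢ proj₂ e → ∀ {c} → Unique (toList (vertices c)) → IsCycle (lift e c)
  isCycle {a , b} a≢b {c} c! = record
    { distinct = Unique.map⁻ (subst Unique (sym (map-proj₂-alternate a b (vertices c))) c!)
    ; adjacent = subst (All _) (sym (cycEdges-alternate m a b (vertices c)))
        (All-alternateEdges a b (λ x≢y → a≢b , x≢y) (λ x≢y → (a≢b ∘ sym) , x≢y) (proper c))
    }

  module _ (F : CycleFactor (m * 2) g) where

    liftAll : List (Fin u × Fin u) → List (Vec (Vertex u g) (m * 2))
    liftAll = concatMap (λ e → map (lift e) (members F))

    liftAll-ok : ∀ {es} → All (λ e → proj₁ e ≢ proj₂ e) es → All IsCycle (liftAll es)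
    liftAll-ok es≢ = All.concat⁺ (All.map⁺ (All.map
      (λ {e} e≢ → All.map⁺ (All.map (λ {c} → isCycle {e} e≢ {c}) (uniques (members F) (λ v → ≤-reflexive (spanning F v))))) es≢))

    ∑-liftAll : ∀ es (f : Vec (Vertex u g) (m * 2) → ℕ) →
      ∑ (liftAll es) f ≡ ∑[ e ∈ es ] ∑[ c ∈ members F ] f (lift e c)
    ∑-liftAll es f = trans (∑-concatMap (λ e → map (lift e) (members F)) es)
      (∑-cong es (λ e → ∑-map (lift e) (members F)))

  δ-≟V : ∀ (a v : Fin u) (x h : Fin g) → δ ((a , x) ≟V (v , h)) ≡ δ (a ≟ v) * δ (x ≟ h)
  δ-≟V a v x h = δ-factor ((a , x) ≟V (v , h)) (a ≟ v) (x ≟ h) (λ { refl → refl , refl }) (λ { refl refl → refl })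

  module _ (h : Fin g) where

    -- Even positions, counted from 0, go to the source row and odd ones to the target row, so the
    -- occurrences of `h` are split by parity.
    evens odds : ∀ {k} → Vec (Fin g) k → ℕ
    evens []       = 0
    evens (x ∷ xs) = δ (x ≟ h) + odds xs
    odds  []       = 0
    odds  (x ∷ xs) = evens xs

    evens+odds : ∀ {k} (xs : Vec (Fin g) k) → evens xs + odds xs ≡ occurs h (toList xs)
    evens+odds []       = refl
    evens+odds (x ∷ xs) = trans (+-assoc (δ (x ≟ h)) _ _)
      (cong (δ (x ≟ h) +_) (trans (+-comm (odds xs) (evens xs)) (evens+odds xs)))

    ∑-alternate : ∀ v {k} a b (xs : Vec (Fin g) k) →
      ∑[ x ∈ toList (alternate a b xs) ] δ (x ≟V (v , h)) ≡ δ (a ≟ v) * evens xs + δ (b ≟ v) * odds xs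
    ∑-alternate v a b []       = sym (cong₂ _+_ (*-zeroʳ (δ (a ≟ v))) (*-zeroʳ (δ (b ≟ v))))
    ∑-alternate v a b (x ∷ xs) = trans (cong₂ _+_ (δ-≟V a v x h) (∑-alternate v b a xs))
      (lemma (δ (a ≟ v)) (δ (b ≟ v)) (δ (x ≟ h)) (evens xs) (odds xs))
      where
      lemma : ∀ a b d e o → a * d + (b * e + a * o) ≡ a * (d + o) + b * e
      lemma = solve-∀

    occ-lift : ∀ F i v → occ (v , h) (concatMap toList (liftAll F (arcs L i))) ≡
      ∑[ e ∈ arcs L i ] δ (proj₁ e ≟ v) * ∑[ c ∈ members F ] evens (vertices c)
      + ∑[ e ∈ arcs L i ] δ (proj₂ e ≟ v) * ∑[ c ∈ members F ] odds (vertices c)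
    occ-lift F i v = begin
      occ (v , h) (concatMap toList (liftAll F (arcs L i)))
        ≡⟨ length-filter-∑ (_≟V (v , h)) (concatMap toList (liftAll F (arcs L i))) ⟩
      ∑[ x ∈ concatMap toList (liftAll F (arcs L i)) ] δ (x ≟V (v , h))
        ≡⟨ ∑-concatMap toList (liftAll F (arcs L i)) ⟩
      ∑[ V ∈ liftAll F (arcs L i) ] ∑[ x ∈ toList V ] δ (x ≟V (v , h))
        ≡⟨ ∑-liftAll F (arcs L i) (λ V → ∑[ x ∈ toList V ] δ (x ≟V (v , h))) ⟩
      ∑[ e ∈ arcs L i ] ∑[ c ∈ members F ] ∑[ x ∈ toList (lift e c) ] δ (x ≟V (v , h))
        ≡⟨ ∑-cong (arcs L i) (λ e → trans
             (∑-cong (members F) (λ c → ∑-alternate v (proj₁ e) (proj₂ e) (vertices c)))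
             (trans (∑-+ (members F) (λ c → δ (proj₁ e ≟ v) * evens (vertices c)) (λ c → δ (proj₂ e ≟ v) * odds (vertices c)))
               (cong₂ _+_ (∑-*ˡ (members F) (δ (proj₁ e ≟ v)) (evens ∘ vertices))
                          (∑-*ˡ (members F) (δ (proj₂ e ≟ v)) (odds ∘ vertices))))) ⟩
      ∑[ e ∈ arcs L i ] (δ (proj₁ e ≟ v) * E + δ (proj₂ e ≟ v) * O)
        ≡⟨ ∑-+ (arcs L i) (λ e → δ (proj₁ e ≟ v) * E) (λ e → δ (proj₂ e ≟ v) * O) ⟩
      ∑[ e ∈ arcs L i ] (δ (proj₁ e ≟ v) * E) + ∑[ e ∈ arcs L i ] (δ (proj₂ e ≟ v) * O)
        ≡⟨ cong₂ _+_ (∑-*ʳ (arcs L i) E (λ e → δ (proj₁ e ≟ v))) (∑-*ʳ (arcs L i) O (λ e → δ (proj₂ e ≟ v))) ⟩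
      ∑[ e ∈ arcs L i ] δ (proj₁ e ≟ v) * E + ∑[ e ∈ arcs L i ] δ (proj₂ e ≟ v) * O ∎
      where
      open ≡-Reasoning
      E = ∑[ c ∈ members F ] evens (vertices c)
      O = ∑[ c ∈ members F ] odds (vertices c)

    evens+odds-spanning : ∀ F → ∑[ c ∈ members F ] evens (vertices c) + ∑[ c ∈ members F ] odds (vertices {m * 2} c) ≡ 1
    evens+odds-spanning F = trans (sym (∑-+ (members F) (evens ∘ vertices) (odds ∘ vertices)))
      (trans (∑-cong (members F) (λ c → evens+odds (vertices c))) (spanning F h))

  -- A row other than `i` is a source once and a target once, so a vertex in it is covered `evens` +
  -- `odds` = 1 times; row `i` is neither.
  liftFactor : CycleFactor (m * 2) g → Fin u → PartialFactor u g (m * 2)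
  liftFactor F i = record
    { missing  = i
    ; cycles   = liftAll F (arcs L i)
    ; cyclesOk = liftAll-ok F (loopless L i)
    ; coverOut = λ { (v , h) v≢i → trans (occ-lift h F i v) (trans
        (cong₂ (λ s t → s * ∑[ c ∈ members F ] evens h (vertices c) + t * ∑[ c ∈ members F ] odds h (vertices c))
          (outside v≢i (sources L i v)) (outside v≢i (targets L i v)))
        (trans (cong₂ _+_ (+-identityʳ (∑[ c ∈ members F ] evens h (vertices c))) (+-identityʳ (∑[ c ∈ members F ] odds h (vertices c))))
               (evens+odds-spanning h F))) }
    ; coverIn  = λ { (v , h) v≡i → trans (occ-lift h F i v)
        (cong₂ (λ s t → s * ∑[ c ∈ members F ] evens h (vertices c) + t * ∑[ c ∈ members F ] odds h (vertices c))
          (inside v≡i (sources L i v)) (inside v≡i (targets L i v))) }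
    }
    where
    outside : ∀ {v n} → v ≢ i → n + δ (i ≟ v) ≡ 1 → n ≡ 1
    outside {v} {n} v≢i eq = trans (sym (trans (cong (n +_) (δ-no (i ≟ v) (v≢i ∘ sym))) (+-identityʳ n))) eq
    inside : ∀ {v n} → v ≡ i → n + δ (i ≟ v) ≡ 1 → n ≡ 0
    inside {v} {n} v≡i eq = +-cancelʳ-≡ 1 n 0 (trans (sym (cong (n +_) (δ-yes (i ≟ v) (sym v≡i)))) eq)

  module _ {v w : Fin u} (v≢w : v ≢ w) (h h′ : Fin g) where

    meets : Vertex u g × Vertex u g → ℕ
    meets (p , q) = δ (p ≟V (v , h)) * δ (q ≟V (w , h′)) + δ (p ≟V (w , h′)) * δ (q ≟V (v , h))

    edgeMult-∑ : ∀ es → edgeMult (v , h) (w , h′) es ≡ ∑ es meets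
    edgeMult-∑ es = trans (length-filter-∑ _ es) (∑-cong es (λ { (p , q) → trans
      (δ-⊎ ((p ≟V (v , h)) ×-dec (q ≟V (w , h′))) ((p ≟V (w , h′)) ×-dec (q ≟V (v , h)))
        (λ { (refl , _) (eq , _) → v≢w (cong proj₁ eq) }))
      (cong₂ _+_ (δ-× (p ≟V (v , h)) (q ≟V (w , h′))) (δ-× (p ≟V (w , h′)) (q ≟V (v , h)))) }))

    -- forth counts the edges h → h′ at even and h′ → h at odd positions, back the others.
    forth back : List (Fin g × Fin g) → ℕ
    forth []             = 0
    forth ((x , y) ∷ es) = δ (x ≟ h) * δ (y ≟ h′) + back es
    back  []             = 0
    back  ((x , y) ∷ es) = δ (x ≟ h′) * δ (y ≟ h) + forth es

    forth+back : ∀ es → forth es + back es ≡ ∑ es (hits h h′)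
    forth+back []             = refl
    forth+back ((x , y) ∷ es) = trans (interchange +-commutativeSemigroup (δ (x ≟ h) * δ (y ≟ h′)) (back es) _ (forth es))
      (cong (hits h h′ (x , y) +_) (trans (+-comm (back es) (forth es)) (forth+back es)))

    -- After the head edge the rows change roles, and so do `forth` and `back`; hence their mutual
    -- recursion.
    ∑-alternateEdges : ∀ a b es → ∑ (alternateEdges a b es) meets ≡
      (δ (a ≟ v) * δ (b ≟ w)) * forth es + (δ (a ≟ w) * δ (b ≟ v)) * back es
    ∑-alternateEdges a b []             = sym (cong₂ _+_ (*-zeroʳ (δ (a ≟ v) * δ (b ≟ w))) (*-zeroʳ (δ (a ≟ w) * δ (b ≟ v))))
    ∑-alternateEdges a b ((x , y) ∷ es) = trans
      (cong₂ _+_ (cong₂ _+_ (cong₂ _*_ (δ-≟V a v x h) (δ-≟V b w y h′)) (cong₂ _*_ (δ-≟V a w x h′) (δ-≟V b v y h)))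
                 (∑-alternateEdges b a es))
      (lemma (δ (a ≟ v)) (δ (b ≟ w)) (δ (a ≟ w)) (δ (b ≟ v)) (δ (x ≟ h)) (δ (y ≟ h′)) (δ (x ≟ h′)) (δ (y ≟ h)) (forth es) (back es))
      where
      lemma : ∀ a b a′ b′ x y x′ y′ f k →
        ((a * x) * (b * y) + (a′ * x′) * (b′ * y′)) + ((b′ * a′) * f + (b * a) * k) ≡
        (a * b) * (x * y + k) + (a′ * b′) * (x′ * y′ + f)
      lemma = solve-∀

    -- Each of the arcs (v , w) and (w , v) occurs for exactly one `i`. The first yields the `forth`
    -- edges and the second the `back` edges, so every occurrence of `h h′` in the cycle is lifted
    -- to the given edge once.
    ∑-arcs : ∀ es → ∑[ i ∈ allFin u ] ∑[ e ∈ arcs L i ] ∑ (alternateEdges (proj₁ e) (proj₂ e) es) meets ≡ ∑ es (hits h h′)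
    ∑-arcs es = begin
      ∑[ i ∈ allFin u ] ∑[ e ∈ arcs L i ] ∑ (alternateEdges (proj₁ e) (proj₂ e) es) meets
        ≡⟨ ∑-cong (allFin u) (λ i → trans (∑-cong (arcs L i) (λ e → ∑-alternateEdges (proj₁ e) (proj₂ e) es))
             (trans (∑-+ (arcs L i) (λ e → vw e * forth es) (λ e → wv e * back es))
                    (cong₂ _+_ (∑-*ʳ (arcs L i) (forth es) vw) (∑-*ʳ (arcs L i) (back es) wv)))) ⟩
      ∑[ i ∈ allFin u ] (∑ (arcs L i) vw * forth es + ∑ (arcs L i) wv * back es)
        ≡⟨ ∑-+ (allFin u) (λ i → ∑ (arcs L i) vw * forth es) (λ i → ∑ (arcs L i) wv * back es) ⟩
      ∑[ i ∈ allFin u ] (∑ (arcs L i) vw * forth es) + ∑[ i ∈ allFin u ] (∑ (arcs L i) wv * back es)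
        ≡⟨ cong₂ _+_ (trans (∑-*ʳ (allFin u) (forth es) (λ i → ∑ (arcs L i) vw)) (cong (_* forth es) (once L v≢w)))
                     (trans (∑-*ʳ (allFin u) (back es) (λ i → ∑ (arcs L i) wv)) (cong (_* back es) (once L (v≢w ∘ sym)))) ⟩
      1 * forth es + 1 * back es
        ≡⟨ cong₂ _+_ (+-identityʳ (forth es)) (+-identityʳ (back es)) ⟩
      forth es + back es
        ≡⟨ forth+back es ⟩
      ∑ es (hits h h′) ∎
      where
      open ≡-Reasoning
      vw wv : Fin u × Fin u → ℕ
      vw e = δ (proj₁ e ≟ v) * δ (proj₂ e ≟ w)
      wv e = δ (proj₁ e ≟ w) * δ (proj₂ e ≟ v)

    ∑-liftFactors : ∀ F → ∑[ i ∈ allFin u ] ∑ (factorEdges (liftFactor F i)) meets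
                        ≡ ∑[ c ∈ members F ] ∑ (edges c) (hits h h′)
    ∑-liftFactors F = begin
      ∑[ i ∈ allFin u ] ∑ (factorEdges (liftFactor F i)) meets
        ≡⟨ ∑-cong (allFin u) (λ i → trans (∑-concatMap (cycEdges ∘ toList) (liftAll F (arcs L i)))
             (trans (∑-liftAll F (arcs L i) (λ V → ∑ (cycEdges (toList V)) meets))
               (∑-cong (arcs L i) (λ e → ∑-cong (members F) (λ c →
                 cong (λ es → ∑ es meets) (cycEdges-alternate m (proj₁ e) (proj₂ e) (vertices c))))))) ⟩
      ∑[ i ∈ allFin u ] ∑[ e ∈ arcs L i ] ∑[ c ∈ members F ] M e c
        ≡⟨ ∑-cong (allFin u) (λ i → ∑-swap (arcs L i) (members F) M) ⟩
      ∑[ i ∈ allFin u ] ∑[ c ∈ members F ] ∑[ e ∈ arcs L i ] M e c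
        ≡⟨ ∑-swap (allFin u) (members F) (λ i c → ∑[ e ∈ arcs L i ] M e c) ⟩
      ∑[ c ∈ members F ] ∑[ i ∈ allFin u ] ∑[ e ∈ arcs L i ] M e c
        ≡⟨ ∑-cong (members F) (λ c → ∑-arcs (edges c)) ⟩
      ∑[ c ∈ members F ] ∑ (edges c) (hits h h′) ∎
      where
      open ≡-Reasoning
      M : Fin u × Fin u → Cycle (m * 2) g → ℕ
      M e c = ∑ (alternateEdges (proj₁ e) (proj₂ e) (edges c)) meets

  liftedFactors : List (PartialFactor u g (m * 2))
  liftedFactors = concatMap (λ F → map (liftFactor F) (allFin u)) (factors S)

  arcs⇒ARCS : ARCS (m * 2) u g 2
  arcs⇒ARCS = liftedFactors , λ { (v , h) (w , h′) (v≢w , h≢h′) → begin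
    edgeMult (v , h) (w , h′) (concatMap factorEdges liftedFactors)
      ≡⟨ edgeMult-∑ v≢w h h′ (concatMap factorEdges liftedFactors) ⟩
    ∑ (concatMap factorEdges liftedFactors) (meets v≢w h h′)
      ≡⟨ ∑-concatMap factorEdges liftedFactors ⟩
    ∑[ P ∈ liftedFactors ] ∑ (factorEdges P) (meets v≢w h h′)
      ≡⟨ ∑-concatMap (λ F → map (liftFactor F) (allFin u)) (factors S) ⟩
    ∑[ F ∈ factors S ] ∑[ P ∈ map (liftFactor F) (allFin u) ] ∑ (factorEdges P) (meets v≢w h h′)
      ≡⟨ ∑-cong (factors S) (λ F → trans (∑-map (liftFactor F) (allFin u)) (∑-liftFactors v≢w h h′ F)) ⟩
    ∑[ F ∈ factors S ] ∑[ c ∈ members F ] ∑ (edges c) (hits h h′)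
      ≡⟨ twice S h≢h′ ⟩
    2 ∎ }
    where open ≡-Reasoning

-- With `s` and `y` one less than k/2 and the y of the theorem, there are 2(y + 1) blocks of s + 1
-- points.
cycleSystem : ∀ s y → CycleSystem (suc s * 2) (suc (suc (y + y)) * suc s)
cycleSystem s y = blowUp s (Rotational.oneFactorization y)
  -- ∞ and the 2s + 1 residues make 2(s + 1) points, as many as two blocks have.
  (subst (CycleSystem (suc s * 2)) (cong suc (sym (+-suc s s))) (Rotational.hamiltonianSystem s))

theorem4p4 : (k y x : ℕ) → 6 ≤ k → 2 ∣ k → ¬ (2 ∣ y) → 1 ≤ x → x ≢ 2 →
    ARCS k (4 * x) (k * y) 2
theorem4p4 k zero x 6≤k 2∣k 2∤y 1≤x x≢2 = ⊥-elim (2∤y (2 ∣0))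
theorem4p4 _ (suc y) (suc x) () (divides zero refl) 2∤y 1≤x x≢2
theorem4p4 _ (suc y) (suc x) 6≤k (divides (suc s) refl) 2∤y 1≤x x≢2 =
  subst₂ (λ u g → ARCS (suc s * 2) u g 2) (u≡ x) (g≡ s y)
    -- Prolonging order 2t + 1 gives order 2t + 2, and t = 2x + 1 makes this 4(x + 1), where `x` is
    -- already the predecessor.
    (Lift.arcs⇒ARCS {suc s} (cycleSystem s y) (Prolongation.arcDecomposition (suc (x + x)) (s≤s z≤n)))
  where
  u≡ : ∀ x → suc (suc (suc (x + x) + suc (x + x))) ≡ 4 * suc x
  u≡ = solve-∀
  g≡ : ∀ s y → suc (suc (y + y)) * suc s ≡ (suc s * 2) * suc y
  g≡ = solve-∀
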